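{- Let $\mathbb F_q$ be a finite field with $q$ elements, let $n\ge 2$, let $a_1,\dots,a_n,b\in\mathbb F_q^*$, and let $m_1,\dots,m_n,k,k_1,\dots,k_n$ be positive integers. Put $d_j=\gcd(m_j,q-1)$ for $j=1,\dots,n$ and $M=\operatorname{lcm}[m_1,\dots,m_n]$. Let $0\le t\le n$ and assume that $\gcd\bigl(\sum_{j=1}^n k_jM/m_j-kM,\;q-1\bigr)=1$, that $d_1,\dots,d_t$ are odd, that $d_{t+1},\dots,d_n$ are even, and that $d_1,\dots,d_t,d_{t+1}/2,\dots,d_n/2$ are pairwise coprime. Then $$ N[(a_1x_1^{m_1}+\dots+a_nx_n^{m_n})^k=bx_1^{k_1}\cdots x_n^{k_n}]=q^{n-1}+(-1)^{n-1}+(-1)^{n-1}\sum_{j=1}^{\lfloor (n-t)/2\rfloor}\eta((-1)^j)\,\sigma_{2j}\bigl(\eta(a_{t+1}),\dots,\eta(a_n)\bigr)\,q^j+E, $$ where $E=\eta\bigl((-1)^{n/2}a_1\cdots a_n\bigr)\,q^{(n-2)/2}(q-1)$ if $t=0$ and $n$ is even, and $E=0$ otherwise.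
   Context: $\mathbb F_q^*=\mathbb F_q\setminus\{0\}$. $N[f_1=f_2]$ denotes the number of solutions $(x_1,\dots,x_n)\in\mathbb F_q^n$ of the equation $f_1(x_1,\dots,x_n)=f_2(x_1,\dots,x_n)$. $\sigma_{2j}(z_1,\dots,z_{n-t})$ is the elementary symmetric polynomial of degree $2j$ in $n-t$ variables. $\eta$ is the quadratic character on $\mathbb F_q$: $\eta(x)=+1,-1,0$ according as $x$ is a nonzero square, a non-square, or zero in $\mathbb F_q$. (Whenever some $d_j$ is even, $q$ is odd since $d_j\mid q-1$; if $t=n$ the sum is empty.) -}

module Defs where

open import Level using (0ℓ)
open import Data.Nat as ℕ using (ℕ; zero; suc)
open import Data.Nat.LCM using (lcm)
open import Data.Integer as ℤ using (ℤ)
open import Data.Fin using (Fin)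
open import Data.List as List using (List; []; _∷_)
open import Data.List.Membership.Propositional using (_∈_)
open import Data.List.Relation.Unary.Unique.Propositional using (Unique)
open import Data.List.Relation.Unary.Any using (any?)
open import Data.Product using (∃)
open import Relation.Nullary using (¬_; yes; no)
open import Relation.Binary.Definitions using (DecidableEquality)
open import Relation.Binary.PropositionalEquality using (_≡_)
open import Algebra.Structures using (IsCommutativeRing)

record FiniteField : Set₁ where
  infixl 6 _+_
  infixl 7 _*_
  field
    Carrier  : Set
    _+_ _*_  : Carrier → Carrier → Carrier
    -_       : Carrier → Carrier
    0# 1#    : Carrier
    isCommutativeRing : IsCommutativeRing _≡_ _+_ _*_ -_ 0# 1#
    0≢1      : ¬ (0# ≡ 1#)
    inverse  : ∀ x → ¬ (x ≡ 0#) → ∃ λ y → x * y ≡ 1#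
    _≟_      : DecidableEquality Carrier
    elements : List Carrier
    complete : ∀ x → x ∈ elements
    unique   : Unique elements

  size : ℕ
  size = List.length elements

  infixr 8 _^_
  _^_ : Carrier → ℕ → Carrier
  x ^ zero  = 1#
  x ^ suc m = x * (x ^ m)

  ΣF : ∀ {n} → (Fin n → Carrier) → Carrier
  ΣF {zero}  f = 0#
  ΣF {suc n} f = f Fin.zero + ΣF (λ i → f (Fin.suc i))
    where import Data.Fin as Fin

  ΠF : ∀ {n} → (Fin n → Carrier) → Carrier
  ΠF {zero}  f = 1#
  ΠF {suc n} f = f Fin.zero * ΠF (λ i → f (Fin.suc i))
    where import Data.Fin as Fin

  η : Carrier → ℤ
  η x with x ≟ 0#
  ... | yes _ = ℤ.0ℤ
  ... | no _ with any? (λ y → (y * y) ≟ x) elements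
  ... | yes _ = ℤ.1ℤ
  ... | no _  = ℤ.-1ℤ

  allTuples : ∀ n → List (Fin n → Carrier)
  allTuples zero = (λ ()) ∷ []
  allTuples (suc n) =
    List.concatMap (λ x → List.map (λ v → cons x v) (allTuples n)) elements
    where
    cons : Carrier → (Fin n → Carrier) → Fin (suc n) → Carrier
    cons x v Fin.zero    = x
    cons x v (Fin.suc i) = v i

  N[_≐_] : ∀ {n} → ((Fin n → Carrier) → Carrier) → ((Fin n → Carrier) → Carrier) → ℕ
  N[_≐_] {n} f₁ f₂ = List.length (List.filter (λ x → f₁ x ≟ f₂ x) (allTuples n))

σ : ℕ → List ℤ → ℤ
σ zero    _        = ℤ.1ℤ
σ (suc k) []       = ℤ.0ℤ
σ (suc k) (z ∷ zs) = z ℤ.* σ k zs ℤ.+ σ (suc k) zs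

sumℤ : List ℤ → ℤ
sumℤ = List.foldr ℤ._+_ ℤ.0ℤ

ΣN : ∀ {n} → (Fin n → ℕ) → ℕ
ΣN {zero}  f = 0
ΣN {suc n} f = f Fin.zero ℕ.+ ΣN (λ i → f (Fin.suc i))
  where import Data.Fin as Fin

lcmF : ∀ {n} → (Fin n → ℕ) → ℕ
lcmF {zero}  f = 1
lcmF {suc n} f = lcm (f Fin.zero) (lcmF (λ i → f (Fin.suc i)))
  where import Data.Fin as Fin

-- natural division, with the (unused here) convention M div 0 = 0
_div_ : ℕ → ℕ → ℕ
m div zero  = 0
m div suc d = m ℕ./ suc d

{-# OPTIONS --safe #-}

-- Solutions with some x_j = 0 are the zeros of the diagonal form S = Σ a_j x_j^{m_j} having a zero
-- coordinate.  On (F*)ⁿ the substitution x_j ↦ u^{M/m_j} x_j multiplies the two sides of the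
-- equation by u^{kM} and u^{Σ k_j M/m_j}; by the gcd hypothesis exactly one unit u makes them equal,
-- so the solutions with all x_j ≠ 0 number #{x ∈ (F*)ⁿ : S ≠ 0} / (q - 1).  Everything is thus
-- reduced to counting the zeros of S in Fⁿ and in (F*)ⁿ.
--
-- The coprimality of the d_j makes it possible to multiply each a_j by an arbitrary unit (j ≤ t) or an
-- arbitrary nonzero square (j > t) without changing these counts; averaging over all such
-- changes replaces the exponent m_j by 1 or 2.  For these exponents the number of x with
-- a_j x^h = s is a combination of 1, η(s) and the delta function at 0, and these three
-- functions span an algebra under convolution, in which Σ a_j x_j^h is counted by a recursion
-- whose solution is the generating function of the elementary symmetric polynomials.
module Submission where

open import Defs
open import Level using (0ℓ)
open import Algebra.Bundles using (AbelianGroup; CommutativeRing)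
open import Algebra.Structures using (IsCommutativeMonoid; IsCommutativeRing)
open import Data.Bool using (true; false; if_then_else_; _∧_)
open import Data.Empty using (⊥-elim)
open import Data.Fin as Fin using (Fin; zero; suc; toℕ; fromℕ<)
open import Data.Fin.Properties using (toℕ<n; toℕ-fromℕ<)
open import Data.Integer as ℤ using (ℤ; +_)
import Data.Integer.Properties as ℤₚ
import Data.Integer.Tactic.RingSolver as ℤSolver
open import Data.List as List using (List; []; _∷_; _++_)
open import Data.List.Membership.Propositional using (_∈_; lose)
open import Data.List.Membership.Propositional.Properties using (∈-map⁺)
open import Data.List.Membership.Propositional.Properties.WithK using (unique∧set⇒bag)
open import Data.List.Properties using (length-tabulate; length-drop; map-upTo)
import Data.List.Relation.Unary.All as All
open import Data.List.Relation.Unary.AllPairs using (_∷_)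
open import Data.List.Relation.Unary.Any using (any?; satisfied; here; there)
open import Data.List.Relation.Unary.Unique.Propositional using (Unique)
open import Data.List.Relation.Unary.Unique.Propositional.Properties using (map⁺)
open import Data.List.Relation.Binary.BagAndSetEquality using (∼bag⇒↭)
open import Data.List.Relation.Binary.Permutation.Propositional as Perm using (_↭_)
open import Data.Nat as ℕ using (ℕ; zero; suc; s≤s; z≤n; _≤_; _<_; _∸_; _≡ᵇ_; _<ᵇ_; _%_)
import Data.Nat.Properties as ℕₚ
open import Data.Nat.Coprimality using (Coprime; coprime-divisor; coprime⇒gcd≡1)
open import Data.Nat.Divisibility using (_∣_; divides; ∣-trans; ∣-refl; 1∣_; ∣m⇒∣m*n; ∣n⇒∣m*n; *-pres-∣; 0∣⇒≡0; ∣⇒≤; ∣1⇒≡1)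
open import Data.Nat.DivMod using (m≡m%n+[m/n]*n; m%n<n; m*n%n≡0; m*n/n≡m; m*[n/m]≡n; [m+kn]%n≡m%n)
open import Data.Nat.GCD using (gcd; gcd-GCD; gcd[m,n]∣m; gcd[m,n]∣n; c*gcd[m,n]≡gcd[cm,cn]; module Bézout)
open import Data.Nat.LCM using (m∣lcm[m,n]; n∣lcm[m,n])
open import Data.Product using (∃; _×_; _,_; proj₁; proj₂)
open import Data.Sum using (_⊎_; inj₁; inj₂)
open import Data.Vec.Functional using () renaming (_∷_ to _◂_)
open import Function using (_∘_; mk⇔)
open import Relation.Nullary using (¬_; Dec; yes; no)
open import Relation.Binary.PropositionalEquality using (_≡_; _≢_; refl; sym; trans; cong; cong₂; subst; module ≡-Reasoning)
open import Algebra.Properties.Group (AbelianGroup.group ℤₚ.+-0-abelianGroup) using () renaming (∙-cancelˡ to ℤ+-cancelˡ)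

-- Sums over lists

-- A coefficient change by units is usually not made of `m_j`-th powers. Coprimality makes it so
-- only up to a factor `z` common to all terms. Such a factor does not affect whether S is 0, but it
-- would move any other value of S. This is why solutions in units are traded for zeros of S before
-- the exponents are touched.
--
-- The counts over the whole space and over tuples of units run in parallel: a parameter `κ` is 0
-- for the first and 1 for the second. Of the convolution algebra, the basis 1, `ψ` = q times delta
-- minus 1, and the character `χ` is used. Constants split off, because `ψ` and `χ` sum to 0. On the
-- rest `ψ` / q is a unit and `χ` behaves like a square root y of w = `ω` q, with `ω` = η(-1). For
-- `κ` = 0 a form contributes the product of its coefficients times y, which leaves a rational part
-- only if no variable is linear and n is even: this is the term E. For `κ` = 1 it contributes a
-- product of factors z y - 1, whose even part is the sum over the σ of even degree.
--
-- All identities are kept in the integers, multiplied by q or q - 1, and these factors are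
-- cancelled once both sides are integral.

module Fold {A : Set} {_∙_ : A → A → A} {ε : A} (isCM : IsCommutativeMonoid _≡_ _∙_ ε) where
  open IsCommutativeMonoid isCM using (assoc; comm; identityˡ; identityʳ)

  fold : {B : Set} → List B → (B → A) → A
  fold []       f = ε
  fold (x ∷ xs) f = f x ∙ fold xs f

  interchange : ∀ a b c d → (a ∙ b) ∙ (c ∙ d) ≡ (a ∙ c) ∙ (b ∙ d)
  interchange a b c d = begin
    (a ∙ b) ∙ (c ∙ d) ≡⟨ assoc a b (c ∙ d) ⟩
    a ∙ (b ∙ (c ∙ d)) ≡⟨ cong (a ∙_) (sym (assoc b c d)) ⟩
    a ∙ ((b ∙ c) ∙ d) ≡⟨ cong (λ e → a ∙ (e ∙ d)) (comm b c) ⟩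
    a ∙ ((c ∙ b) ∙ d) ≡⟨ cong (a ∙_) (assoc c b d) ⟩
    a ∙ (c ∙ (b ∙ d)) ≡⟨ sym (assoc a c (b ∙ d)) ⟩
    (a ∙ c) ∙ (b ∙ d) ∎
    where open ≡-Reasoning

  module _ {B : Set} where

    fold-cong : ∀ (xs : List B) {f g : B → A} → (∀ x → f x ≡ g x) → fold xs f ≡ fold xs g
    fold-cong []       f≗g = refl
    fold-cong (x ∷ xs) f≗g = cong₂ _∙_ (f≗g x) (fold-cong xs f≗g)

    fold-ε : ∀ (xs : List B) → fold xs (λ _ → ε) ≡ ε
    fold-ε []       = refl
    fold-ε (x ∷ xs) = trans (identityˡ _) (fold-ε xs)

    fold-∙ : ∀ (xs : List B) (f g : B → A) → fold xs (λ x → f x ∙ g x) ≡ fold xs f ∙ fold xs g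
    fold-∙ []       f g = sym (identityˡ ε)
    fold-∙ (x ∷ xs) f g = trans (cong ((f x ∙ g x) ∙_) (fold-∙ xs f g)) (interchange _ _ _ _)

    fold-↭ : ∀ {xs ys : List B} (f : B → A) → xs ↭ ys → fold xs f ≡ fold ys f
    fold-↭ f Perm.refl          = refl
    fold-↭ f (Perm.prep x p)    = cong (f x ∙_) (fold-↭ f p)
    fold-↭ f (Perm.swap {xs} {ys} x y p) = begin
      f x ∙ (f y ∙ fold xs f) ≡⟨ sym (assoc _ _ _) ⟩
      (f x ∙ f y) ∙ fold xs f ≡⟨ cong₂ _∙_ (comm _ _) (fold-↭ f p) ⟩
      (f y ∙ f x) ∙ fold ys f ≡⟨ assoc _ _ _ ⟩
      f y ∙ (f x ∙ fold ys f) ∎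
      where open ≡-Reasoning
    fold-↭ f (Perm.trans p q)   = trans (fold-↭ f p) (fold-↭ f q)

    fold-++ : ∀ (xs ys : List B) (f : B → A) → fold (xs ++ ys) f ≡ fold xs f ∙ fold ys f
    fold-++ []       ys f = sym (identityˡ _)
    fold-++ (x ∷ xs) ys f = trans (cong (f x ∙_) (fold-++ xs ys f)) (sym (assoc _ _ _))

    fold-single : ∀ {xs : List B} {c} (f : B → A) → Unique xs → c ∈ xs →
                  (∀ x → x ≢ c → f x ≡ ε) → fold xs f ≡ f c
    fold-single {x ∷ xs} f (x∉xs ∷ u) (here refl) f≡ε =
      trans (cong (f x ∙_) (vanish xs x∉xs)) (identityʳ _)
      where
      vanish : ∀ ys → All.All (x ≢_) ys → fold ys f ≡ ε
      vanish []       All.[]         = refl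
      vanish (y ∷ ys) (x≢y All.∷ ps) =
        trans (cong₂ _∙_ (f≡ε y (x≢y ∘ sym)) (vanish ys ps)) (identityˡ ε)
    fold-single {x ∷ xs} f (x∉xs ∷ u) (there c∈xs) f≡ε =
      trans (cong₂ _∙_ (f≡ε x (All.lookup x∉xs c∈xs)) (fold-single f u c∈xs f≡ε)) (identityˡ _)

  fold-map : ∀ {B C : Set} (h : B → C) xs (f : C → A) → fold (List.map h xs) f ≡ fold xs (f ∘ h)
  fold-map h []       f = refl
  fold-map h (x ∷ xs) f = cong (f (h x) ∙_) (fold-map h xs f)

  fold-concatMap : ∀ {B C : Set} (h : B → List C) xs (f : C → A) →
                   fold (List.concatMap h xs) f ≡ fold xs (λ x → fold (h x) f)
  fold-concatMap h []       f = refl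
  fold-concatMap h (x ∷ xs) f =
    trans (fold-++ (h x) _ f) (cong (fold (h x) f ∙_) (fold-concatMap h xs f))

  fold-swap : ∀ {B C : Set} (xs : List B) (ys : List C) (f : B → C → A) →
              fold xs (λ x → fold ys (f x)) ≡ fold ys (λ y → fold xs (λ x → f x y))
  fold-swap []       ys f = sym (fold-ε ys)
  fold-swap (x ∷ xs) ys f =
    trans (cong (fold ys (f x) ∙_) (fold-swap xs ys f)) (sym (fold-∙ ys (f x) _))

open Fold ℤₚ.+-0-isCommutativeMonoid
  renaming ( fold to ∑; fold-cong to ∑-cong; fold-∙ to ∑-+; fold-ε to ∑-0; fold-↭ to ∑-↭
           ; fold-single to ∑-single; fold-map to ∑-map; fold-concatMap to ∑-concatMap; fold-swap to ∑-swap)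
  using ()

module _ {B : Set} where

  ∑-*ˡ : ∀ (xs : List B) c (f : B → ℤ) → ∑ xs (λ x → c ℤ.* f x) ≡ c ℤ.* ∑ xs f
  ∑-*ˡ []       c f = sym (ℤₚ.*-zeroʳ c)
  ∑-*ˡ (x ∷ xs) c f =
    trans (cong (λ s → c ℤ.* f x ℤ.+ s) (∑-*ˡ xs c f)) (sym (ℤₚ.*-distribˡ-+ c (f x) _))

  ∑-*ʳ : ∀ (xs : List B) c (f : B → ℤ) → ∑ xs (λ x → f x ℤ.* c) ≡ ∑ xs f ℤ.* c
  ∑-*ʳ xs c f = trans (∑-cong xs (λ x → ℤₚ.*-comm (f x) c)) (trans (∑-*ˡ xs c f) (ℤₚ.*-comm c _))

  ∑-const : ∀ (xs : List B) c → ∑ xs (λ _ → c) ≡ + List.length xs ℤ.* c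
  ∑-const []       c = refl
  ∑-const (x ∷ xs) c = trans (cong (λ s → c ℤ.+ s) (∑-const xs c)) (sym (ℤₚ.suc-* (+ List.length xs) c))

  ∑≤0 : ∀ (xs : List B) {f : B → ℤ} → (∀ x → f x ℤ.≤ ℤ.0ℤ) → ∑ xs f ℤ.≤ ℤ.0ℤ
  ∑≤0 []       f≤0 = ℤₚ.≤-refl
  ∑≤0 (x ∷ xs) f≤0 = ℤₚ.+-mono-≤ (f≤0 x) (∑≤0 xs f≤0)

  ∑≡0∧≤0⇒≡0 : ∀ {xs : List B} {f : B → ℤ} {x} → (∀ x → f x ℤ.≤ ℤ.0ℤ) →
              ∑ xs f ≡ ℤ.0ℤ → x ∈ xs → f x ≡ ℤ.0ℤ
  ∑≡0∧≤0⇒≡0 {y ∷ xs} {f} f≤0 eq x∈ = go x∈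
    where
    fy≡0 : f y ≡ ℤ.0ℤ
    fy≡0 = ℤₚ.≤-antisym (f≤0 y)
      (subst (ℤ._≤ f y) eq (subst (f y ℤ.+ ∑ xs f ℤ.≤_) (ℤₚ.+-identityʳ (f y))
        (ℤₚ.+-monoʳ-≤ (f y) (∑≤0 xs f≤0))))
    rest≡0 : ∑ xs f ≡ ℤ.0ℤ
    rest≡0 = trans (sym (ℤₚ.+-identityˡ _)) (trans (cong (ℤ._+ ∑ xs f) (sym fy≡0)) eq)
    go : ∀ {x} → x ∈ y ∷ xs → f x ≡ ℤ.0ℤ
    go (here refl) = fy≡0
    go (there x∈)  = ∑≡0∧≤0⇒≡0 f≤0 rest≡0 x∈

𝟙 : {P : Set} → Dec P → ℤ
𝟙 (yes _) = ℤ.1ℤ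
𝟙 (no  _) = ℤ.0ℤ

𝟙-yes : {P : Set} (p? : Dec P) → P → 𝟙 p? ≡ ℤ.1ℤ
𝟙-yes (yes _) p = refl
𝟙-yes (no ¬p) p = ⊥-elim (¬p p)

𝟙-no : {P : Set} (p? : Dec P) → ¬ P → 𝟙 p? ≡ ℤ.0ℤ
𝟙-no (yes p) ¬p = ⊥-elim (¬p p)
𝟙-no (no _)  ¬p = refl

𝟙-cong : {P Q : Set} (p? : Dec P) (q? : Dec Q) → (P → Q) → (Q → P) → 𝟙 p? ≡ 𝟙 q?
𝟙-cong (yes p) q? P→Q Q→P = sym (𝟙-yes q? (P→Q p))
𝟙-cong (no ¬p) q? P→Q Q→P = sym (𝟙-no q? (¬p ∘ Q→P))

length-filter≡∑𝟙 : ∀ {B : Set} {P : B → Set} (P? : ∀ x → Dec (P x)) xs →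
                   + List.length (List.filter P? xs) ≡ ∑ xs (λ x → 𝟙 (P? x))
length-filter≡∑𝟙 P? []       = refl
length-filter≡∑𝟙 P? (x ∷ xs) with P? x
... | yes _ = cong (λ s → ℤ.1ℤ ℤ.+ s) (length-filter≡∑𝟙 P? xs)
... | no _  = trans (length-filter≡∑𝟙 P? xs) (sym (ℤₚ.+-identityˡ _))

-- Finite fields

module FieldProperties (F : FiniteField) where
  open FiniteField F
  open IsCommutativeRing isCommutativeRing public
    using ( +-assoc; +-comm; +-identityˡ; +-identityʳ; -‿inverseʳ; -‿inverseˡ; zeroˡ; zeroʳ
          ; *-assoc; *-comm; *-identityˡ; *-identityʳ; distribˡ; distribʳ
          ; +-isCommutativeMonoid; *-isCommutativeMonoid)

  commutativeRing : CommutativeRing 0ℓ 0ℓ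
  commutativeRing = record { isCommutativeRing = isCommutativeRing }

  open import Algebra.Properties.Ring (CommutativeRing.ring commutativeRing) public
    using (-1*x≈-x; -‿distribˡ-*; -‿distribʳ-*; -‿involutive; -‿+-comm; +-cancelʳ)

  1≢0 : 1# ≢ 0#
  1≢0 = 0≢1 ∘ sym

  infix 9 _⁻¹
  -- 0 ⁻¹ = 1, so that x ⁻¹ is always a unit.
  _⁻¹ : Carrier → Carrier
  x ⁻¹ with x ≟ 0#
  ... | yes _  = 1#
  ... | no x≢0 = proj₁ (inverse x x≢0)

  x*x⁻¹≡1 : ∀ {x} → x ≢ 0# → x * x ⁻¹ ≡ 1#
  x*x⁻¹≡1 {x} x≢0 with x ≟ 0#
  ... | yes x≡0 = ⊥-elim (x≢0 x≡0)
  ... | no x≢0′ = proj₂ (inverse x x≢0′)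

  x⁻¹*x≡1 : ∀ {x} → x ≢ 0# → x ⁻¹ * x ≡ 1#
  x⁻¹*x≡1 x≢0 = trans (*-comm _ _) (x*x⁻¹≡1 x≢0)

  x⁻¹≢0 : ∀ x → x ⁻¹ ≢ 0#
  x⁻¹≢0 x eq with x ≟ 0#
  ... | yes _  = 1≢0 eq
  ... | no x≢0 = 1≢0 (trans (sym (proj₂ (inverse x x≢0))) (trans (cong (x *_) eq) (zeroʳ x)))

  x⁻¹*[x*y]≡y : ∀ {x} y → x ≢ 0# → x ⁻¹ * (x * y) ≡ y
  x⁻¹*[x*y]≡y y x≢0 =
    trans (sym (*-assoc _ _ y)) (trans (cong (_* y) (x⁻¹*x≡1 x≢0)) (*-identityˡ y))

  x*[x⁻¹*y]≡y : ∀ {x} y → x ≢ 0# → x * (x ⁻¹ * y) ≡ y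
  x*[x⁻¹*y]≡y y x≢0 =
    trans (sym (*-assoc _ _ y)) (trans (cong (_* y) (x*x⁻¹≡1 x≢0)) (*-identityˡ y))

  *-cancelˡ : ∀ {x} y z → x ≢ 0# → x * y ≡ x * z → y ≡ z
  *-cancelˡ {x} y z x≢0 eq =
    trans (sym (x⁻¹*[x*y]≡y y x≢0)) (trans (cong (x ⁻¹ *_) eq) (x⁻¹*[x*y]≡y z x≢0))

  *≢0 : ∀ {x y} → x ≢ 0# → y ≢ 0# → x * y ≢ 0#
  *≢0 {x} {y} x≢0 y≢0 eq = y≢0 (*-cancelˡ y 0# x≢0 (trans eq (sym (zeroʳ x))))

  ^≢0 : ∀ {x} n → x ≢ 0# → x ^ n ≢ 0#
  ^≢0 zero    x≢0 = 1≢0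
  ^≢0 (suc n) x≢0 = *≢0 x≢0 (^≢0 n x≢0)

  0^n≡0 : ∀ {n} → 1 ℕ.≤ n → 0# ^ n ≡ 0#
  0^n≡0 {suc n} _ = zeroˡ _

  1^n≡1 : ∀ n → 1# ^ n ≡ 1#
  1^n≡1 zero    = refl
  1^n≡1 (suc n) = trans (*-identityˡ _) (1^n≡1 n)

  ^-distribˡ-+ : ∀ x m n → x ^ (m ℕ.+ n) ≡ x ^ m * x ^ n
  ^-distribˡ-+ x zero    n = sym (*-identityˡ _)
  ^-distribˡ-+ x (suc m) n = trans (cong (x *_) (^-distribˡ-+ x m n)) (sym (*-assoc _ _ _))

  *-interchange : ∀ a b c d → (a * b) * (c * d) ≡ (a * c) * (b * d)
  *-interchange = Fold.interchange *-isCommutativeMonoid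

  ^-distribʳ-* : ∀ x y n → (x * y) ^ n ≡ x ^ n * y ^ n
  ^-distribʳ-* x y zero    = sym (*-identityˡ 1#)
  ^-distribʳ-* x y (suc n) =
    trans (cong ((x * y) *_) (^-distribʳ-* x y n)) (*-interchange x y (x ^ n) (y ^ n))

  ^-assocʳ : ∀ x m n → (x ^ m) ^ n ≡ x ^ (m ℕ.* n)
  ^-assocʳ x zero    n = 1^n≡1 n
  ^-assocʳ x (suc m) n = begin
    (x * x ^ m) ^ n         ≡⟨ ^-distribʳ-* x (x ^ m) n ⟩
    x ^ n * (x ^ m) ^ n     ≡⟨ cong ((x ^ n) *_) (^-assocʳ x m n) ⟩
    x ^ n * x ^ (m ℕ.* n)   ≡⟨ sym (^-distribˡ-+ x n (m ℕ.* n)) ⟩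
    x ^ (n ℕ.+ m ℕ.* n)     ∎
    where open ≡-Reasoning

  [x⁻¹]^n*x^n≡1 : ∀ {x} n → x ≢ 0# → (x ⁻¹) ^ n * x ^ n ≡ 1#
  [x⁻¹]^n*x^n≡1 {x} n x≢0 =
    trans (sym (^-distribʳ-* (x ⁻¹) x n)) (trans (cong (_^ n) (x⁻¹*x≡1 x≢0)) (1^n≡1 n))

  ΣF-cong : ∀ {n} {f g : Fin n → Carrier} → (∀ i → f i ≡ g i) → ΣF f ≡ ΣF g
  ΣF-cong {zero}  f≗g = refl
  ΣF-cong {suc n} f≗g = cong₂ _+_ (f≗g Fin.zero) (ΣF-cong (f≗g ∘ Fin.suc))

  ΠF-cong : ∀ {n} {f g : Fin n → Carrier} → (∀ i → f i ≡ g i) → ΠF f ≡ ΠF g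
  ΠF-cong {zero}  f≗g = refl
  ΠF-cong {suc n} f≗g = cong₂ _*_ (f≗g Fin.zero) (ΠF-cong (f≗g ∘ Fin.suc))

  ΣF-*ˡ : ∀ {n} c (f : Fin n → Carrier) → ΣF (λ i → c * f i) ≡ c * ΣF f
  ΣF-*ˡ {zero}  c f = sym (zeroʳ c)
  ΣF-*ˡ {suc n} c f =
    trans (cong (λ s → c * f Fin.zero + s) (ΣF-*ˡ c (f ∘ Fin.suc))) (sym (distribˡ c _ _))

  ΠF-* : ∀ {n} (f g : Fin n → Carrier) → ΠF (λ i → f i * g i) ≡ ΠF f * ΠF g
  ΠF-* {zero}  f g = sym (*-identityˡ 1#)
  ΠF-* {suc n} f g =
    trans (cong ((f Fin.zero * g Fin.zero) *_) (ΠF-* (f ∘ Fin.suc) (g ∘ Fin.suc))) (*-interchange _ _ _ _)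

  ΠF≢0 : ∀ {n} {f : Fin n → Carrier} → (∀ i → f i ≢ 0#) → ΠF f ≢ 0#
  ΠF≢0 {zero}  f≢0 = 1≢0
  ΠF≢0 {suc n} f≢0 = *≢0 (f≢0 Fin.zero) (ΠF≢0 (f≢0 ∘ Fin.suc))

  ΠF-^ : ∀ {n} u (e : Fin n → ℕ) → ΠF (λ i → u ^ e i) ≡ u ^ ΣN e
  ΠF-^ {zero}  u e = refl
  ΠF-^ {suc n} u e =
    trans (cong ((u ^ e Fin.zero) *_) (ΠF-^ u (e ∘ Fin.suc))) (sym (^-distribˡ-+ u (e Fin.zero) _))

  -- Two duplicate-free lists with the same members are equal as bags, hence permutations of each
  -- other. Every change of variable in a sum or product over the field rests on this.
  map-bijective-↭ : (π π⁻¹ : Carrier → Carrier) → (∀ x → π (π⁻¹ x) ≡ x) → (∀ x → π⁻¹ (π x) ≡ x) →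
                    List.map π elements ↭ elements
  map-bijective-↭ π π⁻¹ invˡ invʳ = ∼bag⇒↭ (unique∧set⇒bag
    (map⁺ (λ {x} {y} eq → trans (sym (invʳ x)) (trans (cong π⁻¹ eq) (invʳ y))) unique) unique
    (λ {x} → mk⇔ (λ _ → complete x)
                 (λ _ → subst (_∈ List.map π elements) (invˡ x) (∈-map⁺ π (complete (π⁻¹ x))))))

  module Reindex {A : Set} {_∙_ : A → A → A} {ε : A} (isCM : IsCommutativeMonoid _≡_ _∙_ ε) where
    open Fold isCM

    reindex : (π π⁻¹ : Carrier → Carrier) → (∀ x → π (π⁻¹ x) ≡ x) → (∀ x → π⁻¹ (π x) ≡ x) →
              (f : Carrier → A) → fold elements (f ∘ π) ≡ fold elements f
    reindex π π⁻¹ invˡ invʳ f =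
      trans (sym (fold-map π elements f)) (fold-↭ f (map-bijective-↭ π π⁻¹ invˡ invʳ))

    reindex-scale : ∀ {u} → u ≢ 0# → (f : Carrier → A) → fold elements (λ x → f (u * x)) ≡ fold elements f
    reindex-scale {u} u≢0 = reindex (u *_) (u ⁻¹ *_) (λ x → x*[x⁻¹*y]≡y x u≢0) (λ x → x⁻¹*[x*y]≡y x u≢0)

    reindex-shift : ∀ c (f : Carrier → A) → fold elements (λ x → f (c + x)) ≡ fold elements f
    reindex-shift c = reindex (λ x → c + x) (λ x → - c + x)
      (λ x → trans (sym (+-assoc _ _ x)) (trans (cong (_+ x) (-‿inverseʳ c)) (+-identityˡ x)))
      (λ x → trans (sym (+-assoc _ _ x)) (trans (cong (_+ x) (-‿inverseˡ c)) (+-identityˡ x)))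

    reindex-reflect : ∀ c (f : Carrier → A) → fold elements (λ x → f (c + - x)) ≡ fold elements f
    reindex-reflect c = reindex (λ x → c + - x) (λ x → c + - x) invol invol
      where
      invol : ∀ x → c + - (c + - x) ≡ x
      invol x = begin
        c + - (c + - x)     ≡⟨ cong (λ y → c + y) (sym (-‿+-comm c (- x))) ⟩
        c + (- c + - - x)   ≡⟨ sym (+-assoc c (- c) _) ⟩
        c + - c + - - x     ≡⟨ cong₂ _+_ (-‿inverseʳ c) (-‿involutive x) ⟩
        0# + x              ≡⟨ +-identityˡ x ⟩
        x                   ∎
        where open ≡-Reasoning

  open Reindex ℤₚ.+-0-isCommutativeMonoid public
    renaming (reindex-scale to ∑-scale; reindex-shift to ∑-shift; reindex-reflect to ∑-reflect)
    using ()

  ∑F : (Carrier → ℤ) → ℤ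
  ∑F = ∑ elements

  ∑-𝟙 : ∀ c (g : Carrier → ℤ) → ∑F (λ x → 𝟙 (x ≟ c) ℤ.* g x) ≡ g c
  ∑-𝟙 c g = begin
    ∑F (λ x → 𝟙 (x ≟ c) ℤ.* g x) ≡⟨ ∑-single _ unique (complete c) (λ x x≢c → cong (ℤ._* g x) (𝟙-no (x ≟ c) x≢c)) ⟩
    𝟙 (c ≟ c) ℤ.* g c            ≡⟨ cong (ℤ._* g c) (𝟙-yes (c ≟ c) refl) ⟩
    ℤ.1ℤ ℤ.* g c                 ≡⟨ ℤₚ.*-identityˡ (g c) ⟩
    g c                          ∎
    where open ≡-Reasoning

  size≢0 : size ≢ 0
  size≢0 eq with elements | complete 0#
  size≢0 () | _ ∷ _ | _

  size≡suc : size ≡ suc (size ℕ.∸ 1)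
  size≡suc with size | size≢0
  ... | zero  | ≢0 = ⊥-elim (≢0 refl)
  ... | suc _ | _  = refl

  module Πₑ = Fold *-isCommutativeMonoid
  module Σₑ = Fold +-isCommutativeMonoid

  Π-const : ∀ (xs : List Carrier) u → Πₑ.fold xs (λ _ → u) ≡ u ^ List.length xs
  Π-const []       u = refl
  Π-const (x ∷ xs) u = cong (u *_) (Π-const xs u)

  Π≢0 : ∀ (xs : List Carrier) {f : Carrier → Carrier} → (∀ x → f x ≢ 0#) → Πₑ.fold xs f ≢ 0#
  Π≢0 []       f≢0 = 1≢0
  Π≢0 (x ∷ xs) f≢0 = *≢0 (f≢0 x) (Π≢0 xs f≢0)

  -- Lets a product over all of `elements` act as the product of the units, since 0 contributes 1.
  unitPart : Carrier → Carrier
  unitPart x with x ≟ 0#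
  ... | yes _ = 1#
  ... | no _  = x

  unitPart≢0 : ∀ x → unitPart x ≢ 0#
  unitPart≢0 x with x ≟ 0#
  ... | yes _  = 1≢0
  ... | no x≢0 = x≢0

  -- Scaling by `u` permutes the field, so it preserves the product `W` of the units. Multiplying
  -- each of the q factors by `u` agrees with this scaling except at 0, where a surplus `u` remains,
  -- recorded by `at0`. Hence `W` times u^q equals `W` times `u`.
  u^q≡u : ∀ {u} → u ≢ 0# → u ^ size ≡ u
  u^q≡u {u} u≢0 = *-cancelˡ _ _ (Π≢0 elements unitPart≢0) (begin
    W * u ^ size                      ≡⟨ *-comm _ _ ⟩
    u ^ size * W                      ≡⟨ cong (_* W) (sym (Π-const elements u)) ⟩
    Πₑ.fold elements (λ _ → u) * W    ≡⟨ sym (Πₑ.fold-∙ elements _ _) ⟩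
    Πₑ.fold elements (λ x → u * unitPart x) ≡⟨ Πₑ.fold-cong elements pointwise ⟩
    Πₑ.fold elements (λ x → unitPart (u * x) * at0 x) ≡⟨ Πₑ.fold-∙ elements _ _ ⟩
    Πₑ.fold elements (λ x → unitPart (u * x)) * Πₑ.fold elements at0
      ≡⟨ cong₂ _*_ (Reindex.reindex-scale *-isCommutativeMonoid u≢0 unitPart)
                   (trans (Πₑ.fold-single at0 unique (complete 0#) at0-≢) at0-0) ⟩
    W * u                             ∎)
    where
    open ≡-Reasoning
    W = Πₑ.fold elements unitPart
    at0 : Carrier → Carrier
    at0 x with x ≟ 0#
    ... | yes _ = u
    ... | no _  = 1#
    at0-0 : at0 0# ≡ u
    at0-0 with 0# ≟ 0#
    ... | yes _  = refl
    ... | no 0≢0 = ⊥-elim (0≢0 refl)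
    at0-≢ : ∀ x → x ≢ 0# → at0 x ≡ 1#
    at0-≢ x x≢0 with x ≟ 0#
    ... | yes x≡0 = ⊥-elim (x≢0 x≡0)
    ... | no _    = refl
    pointwise : ∀ x → u * unitPart x ≡ unitPart (u * x) * at0 x
    pointwise x with x ≟ 0# | (u * x) ≟ 0#
    ... | yes _   | yes _     = *-comm u 1#
    ... | yes x≡0 | no ux≢0   = ⊥-elim (ux≢0 (trans (cong (u *_) x≡0) (zeroʳ u)))
    ... | no x≢0  | yes ux≡0  = ⊥-elim (*≢0 u≢0 x≢0 ux≡0)
    ... | no _    | no _      = sym (*-identityʳ _)

  fermat : ∀ {u} → u ≢ 0# → u ^ (size ℕ.∸ 1) ≡ 1#
  fermat {u} u≢0 = *-cancelˡ _ _ u≢0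
    (trans (cong (u ^_) (sym size≡suc)) (trans (u^q≡u u≢0) (sym (*-identityʳ u))))

  _×1 : ℕ → Carrier
  zero  ×1 = 0#
  suc n ×1 = 1# + n ×1

  -- The shift by 1 permutes the field and so fixes the sum of its elements, while it adds 1 once
  -- for each element.
  size×1≡0 : size ×1 ≡ 0#
  size×1≡0 = +-cancelʳ S _ _ (begin
    size ×1 + S                           ≡⟨ cong (_+ S) (sym (Σ-1 elements)) ⟩
    Σₑ.fold elements (λ _ → 1#) + S       ≡⟨ sym (Σₑ.fold-∙ elements _ _) ⟩
    Σₑ.fold elements (λ x → 1# + x)       ≡⟨ Reindex.reindex-shift +-isCommutativeMonoid 1# (λ x → x) ⟩
    S                                     ≡⟨ sym (+-identityˡ S) ⟩
    0# + S                                ∎)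
    where
    open ≡-Reasoning
    S = Σₑ.fold elements (λ x → x)
    Σ-1 : ∀ xs → Σₑ.fold xs (λ (_ : Carrier) → 1#) ≡ List.length xs ×1
    Σ-1 []       = refl
    Σ-1 (x ∷ xs) = cong (λ s → 1# + s) (Σ-1 xs)

  odd-size⇒1+1≢0 : ∀ w → size ≡ suc (w ℕ.* 2) → 1# + 1# ≢ 0#
  odd-size⇒1+1≢0 w odd 1+1≡0 = 1≢0 (trans (sym odd×1) (trans (cong _×1 (sym odd)) size×1≡0))
    where
    even×1 : ∀ w → (w ℕ.* 2) ×1 ≡ 0#
    even×1 zero    = refl
    even×1 (suc w) = trans (sym (+-assoc 1# 1# _)) (trans (cong₂ _+_ 1+1≡0 (even×1 w)) (+-identityˡ 0#))
    odd×1 : suc (w ℕ.* 2) ×1 ≡ 1#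
    odd×1 = trans (cong (λ s → 1# + s) (even×1 w)) (+-identityʳ 1#)

-- Sums over tuples and the averaging argument

module Tuples (F : FiniteField) where
  open FiniteField F
  open FieldProperties F

  -- Tuples are functions, so tuples with equal entries need not be propositionally equal. A summand
  -- has to respect pointwise equality before its variables can be split off or rescaled.
  Extensional : ∀ {n} → ((Fin n → Carrier) → ℤ) → Set
  Extensional g = ∀ {u v} → (∀ i → u i ≡ v i) → g u ≡ g v

  ∑T : ∀ n → ((Fin n → Carrier) → ℤ) → ℤ
  ∑T n = ∑ (allTuples n)

  -- The constructor local to `allTuples` agrees with `_◂_` only pointwise, which is where
  -- extensionality enters.
  ∑T-suc : ∀ {n} (g : (Fin (suc n) → Carrier) → ℤ) → Extensional g →
           ∑T (suc n) g ≡ ∑F (λ x → ∑T n (λ v → g (x ◂ v)))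
  ∑T-suc {n} g ext = trans (∑-concatMap _ elements g)
    (∑-cong elements λ x → trans (∑-map _ (allTuples n) g)
      (∑-cong (allTuples n) λ v → ext λ { zero → refl ; (suc i) → refl }))

  ∑T-scale : ∀ {n} {c : Fin n → Carrier} → (∀ i → c i ≢ 0#) → ∀ g → Extensional g →
             ∑T n (λ x → g (λ i → c i * x i)) ≡ ∑T n g
  ∑T-scale {zero}  c≢0 g ext = cong (ℤ._+ ℤ.0ℤ) (ext λ ())
  ∑T-scale {suc n} {c} c≢0 g ext = begin
    ∑T (suc n) (λ x → g (λ i → c i * x i))
      ≡⟨ ∑T-suc _ (λ u≗v → ext (λ i → cong (c i *_) (u≗v i))) ⟩
    ∑F (λ x → ∑T n (λ v → g (λ i → c i * (x ◂ v) i)))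
      ≡⟨ ∑-cong elements (λ x → ∑-cong (allTuples n) λ v → ext λ { zero → refl ; (suc i) → refl }) ⟩
    ∑F (λ x → ∑T n (λ v → g (c zero * x ◂ λ i → c (suc i) * v i)))
      ≡⟨ ∑-cong elements (λ x → ∑T-scale (c≢0 ∘ suc) (λ v → g (c zero * x ◂ v)) (extTail _)) ⟩
    ∑F (λ x → ∑T n (λ v → g (c zero * x ◂ v)))
      ≡⟨ ∑-scale (c≢0 zero) (λ x → ∑T n (λ v → g (x ◂ v))) ⟩
    ∑F (λ x → ∑T n (λ v → g (x ◂ v)))
      ≡⟨ sym (∑T-suc g ext) ⟩
    ∑T (suc n) g ∎
    where
    open ≡-Reasoning
    extTail : ∀ x → Extensional (λ v → g (x ◂ v))
    extTail x u≗v = ext λ { zero → refl ; (suc i) → u≗v i }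

  ρ : ℤ → Carrier → ℤ
  ρ κ x = ℤ.1ℤ ℤ.- κ ℤ.* 𝟙 (x ≟ 0#)

  -- weight κ is the indicator of (F*)ⁿ for κ = 1 and constantly 1 for κ = 0.
  weight : ∀ {n} → ℤ → (Fin n → Carrier) → ℤ
  weight {zero}  κ x = ℤ.1ℤ
  weight {suc n} κ x = ρ κ (x zero) ℤ.* weight κ (x ∘ suc)

  weight-ext : ∀ {n} κ → Extensional (weight {n} κ)
  weight-ext {zero}  κ u≗v = refl
  weight-ext {suc n} κ u≗v = cong₂ ℤ._*_ (cong (ρ κ) (u≗v zero)) (weight-ext κ (u≗v ∘ suc))

  ρ-scale : ∀ κ {c} x → c ≢ 0# → ρ κ (c * x) ≡ ρ κ x
  ρ-scale κ {c} x c≢0 = cong (λ i → ℤ.1ℤ ℤ.- κ ℤ.* i) (𝟙-cong ((c * x) ≟ 0#) (x ≟ 0#)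
    (λ eq → *-cancelˡ x 0# c≢0 (trans eq (sym (zeroʳ c))))
    (λ eq → trans (cong (c *_) eq) (zeroʳ c)))

  weight-scale : ∀ {n} κ {c : Fin n → Carrier} x → (∀ i → c i ≢ 0#) →
                 weight κ (λ i → c i * x i) ≡ weight κ x
  weight-scale {zero}  κ x c≢0 = refl
  weight-scale {suc n} κ x c≢0 =
    cong₂ ℤ._*_ (ρ-scale κ (x zero) (c≢0 zero)) (weight-scale κ (x ∘ suc) (c≢0 ∘ suc))

  weight-0 : ∀ {n} (x : Fin n → Carrier) → weight ℤ.0ℤ x ≡ ℤ.1ℤ
  weight-0 {zero}  x = refl
  weight-0 {suc n} x = trans (ℤₚ.*-identityˡ _) (weight-0 (x ∘ suc))

  ρ1-≢0 : ∀ {x} → x ≢ 0# → ρ ℤ.1ℤ x ≡ ℤ.1ℤ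
  ρ1-≢0 {x} x≢0 = cong (λ i → ℤ.1ℤ ℤ.- ℤ.1ℤ ℤ.* i) (𝟙-no (x ≟ 0#) x≢0)

  ρ1-0 : ∀ {x} → x ≡ 0# → ρ ℤ.1ℤ x ≡ ℤ.0ℤ
  ρ1-0 {x} x≡0 = cong (λ i → ℤ.1ℤ ℤ.- ℤ.1ℤ ℤ.* i) (𝟙-yes (x ≟ 0#) x≡0)

  weight-1 : ∀ {n} (x : Fin n → Carrier) →
             (∃ (λ i → x i ≡ 0#) × weight ℤ.1ℤ x ≡ ℤ.0ℤ) ⊎ ((∀ i → x i ≢ 0#) × weight ℤ.1ℤ x ≡ ℤ.1ℤ)
  weight-1 {zero}  x = inj₂ ((λ ()) , refl)
  weight-1 {suc n} x with x zero ≟ 0# | weight-1 (x ∘ suc)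
  ... | yes x₀≡0 | _ = inj₁ ((zero , x₀≡0) , refl)
  ... | no x₀≢0  | inj₁ ((i , xᵢ≡0) , w≡0) = inj₁ ((suc i , xᵢ≡0) , trans (ℤₚ.*-identityˡ _) w≡0)
  ... | no x₀≢0  | inj₂ (x≢0 , w≡1) =
    inj₂ ((λ { zero → x₀≢0 ; (suc i) → x≢0 i }) , trans (ℤₚ.*-identityˡ _) w≡1)

  q : ℤ
  q = + size

  ∑-ρ : ∀ κ → ∑F (ρ κ) ≡ q ℤ.- κ
  ∑-ρ κ = begin
    ∑F (λ x → ℤ.1ℤ ℤ.- κ ℤ.* 𝟙 (x ≟ 0#))       ≡⟨ ∑-cong elements (λ x → regroup κ (𝟙 (x ≟ 0#))) ⟩
    ∑F (λ x → ℤ.1ℤ ℤ.+ 𝟙 (x ≟ 0#) ℤ.* ℤ.- κ)   ≡⟨ ∑-+ elements _ _ ⟩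
    ∑F (λ _ → ℤ.1ℤ) ℤ.+ ∑F (λ x → 𝟙 (x ≟ 0#) ℤ.* ℤ.- κ)
      ≡⟨ cong₂ ℤ._+_ (trans (∑-const elements ℤ.1ℤ) (ℤₚ.*-identityʳ q)) (∑-𝟙 0# (λ _ → ℤ.- κ)) ⟩
    q ℤ.- κ ∎
    where
    open ≡-Reasoning
    regroup : ∀ κ i → ℤ.1ℤ ℤ.- κ ℤ.* i ≡ ℤ.1ℤ ℤ.+ i ℤ.* ℤ.- κ
    regroup = ℤSolver.solve-∀

  ∑T-weight : ∀ n κ → ∑T n (weight κ) ≡ (q ℤ.- κ) ℤ.^ n
  ∑T-weight zero    κ = refl
  ∑T-weight (suc n) κ = begin
    ∑T (suc n) (weight κ)                            ≡⟨ ∑T-suc _ (weight-ext κ) ⟩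
    ∑F (λ x → ∑T n (λ v → ρ κ x ℤ.* weight κ v))     ≡⟨ ∑-cong elements (λ x → ∑-*ˡ (allTuples n) (ρ κ x) (weight κ)) ⟩
    ∑F (λ x → ρ κ x ℤ.* ∑T n (weight κ))             ≡⟨ ∑-*ʳ elements (∑T n (weight κ)) (ρ κ) ⟩
    ∑F (ρ κ) ℤ.* ∑T n (weight κ)                     ≡⟨ cong₂ ℤ._*_ (∑-ρ κ) (∑T-weight n κ) ⟩
    (q ℤ.- κ) ℤ.* (q ℤ.- κ) ℤ.^ n                    ∎
    where open ≡-Reasoning

  module _ {n : ℕ} (a : Fin n → Carrier) where

    diagonal : (Fin n → ℕ) → (Fin n → Carrier) → Carrier
    diagonal m x = ΣF (λ j → a j * x j ^ m j)

    diagonal-cong : ∀ m {x y} → (∀ i → x i ≡ y i) → diagonal m x ≡ diagonal m y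
    diagonal-cong m x≗y = ΣF-cong (λ j → cong (λ z → a j * z ^ m j) (x≗y j))

    count : ℤ → (Fin n → ℕ) → ℤ
    count κ m = ∑T n (λ x → weight κ x ℤ.* 𝟙 (diagonal m x ≟ 0#))

    count-ext : ∀ κ m → Extensional (λ x → weight κ x ℤ.* 𝟙 (diagonal m x ≟ 0#))
    count-ext κ m x≗y = cong₂ (λ w s → w ℤ.* 𝟙 (s ≟ 0#)) (weight-ext κ x≗y) (diagonal-cong m x≗y)

    -- Multiplying the coefficients by the h-th powers of units amounts to a common factor
    -- and m-th powers of units.
    PowersAbsorb : (h m : Fin n → ℕ) → Set
    PowersAbsorb h m = ∀ (v : Fin n → Carrier) → (∀ i → v i ≢ 0#) →
      ∃ λ z → ∃ λ (y : Fin n → Carrier) → z ≢ 0# × (∀ i → y i ≢ 0#) × (∀ i → v i ^ h i ≡ z * y i ^ m i)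

    -- Replacing `x j` by `y j * x j` permutes the tuples and preserves the weight. It turns the
    -- twisted form into `z` times the original one, and a unit factor does not change whether a
    -- value is 0.
    count-twist : ∀ κ {h m} → PowersAbsorb h m → ∀ v → (∀ i → v i ≢ 0#) →
      count κ m ≡ ∑T n (λ x → weight κ x ℤ.* 𝟙 (ΣF (λ j → a j * (v j ^ h j * x j ^ m j)) ≟ 0#))
    count-twist κ {h} {m} absorb v v≢0 with absorb v v≢0
    ... | z , y , z≢0 , y≢0 , vʰ≡zyᵐ =
      trans (sym (∑T-scale y≢0 _ (count-ext κ m))) (∑-cong (allTuples n) λ x →
        cong₂ ℤ._*_ (weight-scale κ x y≢0) (𝟙-cong (_ ≟ 0#) (_ ≟ 0#)
          (λ eq → trans (factor x) (trans (cong (z *_) eq) (zeroʳ z)))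
          (λ eq → *-cancelˡ _ _ z≢0 (trans (sym (factor x)) (trans eq (sym (zeroʳ z)))))))
      where
      open ≡-Reasoning
      factor : ∀ x → ΣF (λ j → a j * (v j ^ h j * x j ^ m j)) ≡ z * diagonal m (λ j → y j * x j)
      factor x = trans (ΣF-cong λ j → begin
        a j * (v j ^ h j * x j ^ m j)         ≡⟨ cong (λ p → a j * (p * x j ^ m j)) (vʰ≡zyᵐ j) ⟩
        a j * (z * y j ^ m j * x j ^ m j)     ≡⟨ cong (a j *_) (*-assoc _ _ _) ⟩
        a j * (z * (y j ^ m j * x j ^ m j))   ≡⟨ cong (λ p → a j * (z * p)) (sym (^-distribʳ-* (y j) (x j) (m j))) ⟩
        a j * (z * (y j * x j) ^ m j)         ≡⟨ sym (*-assoc _ _ _) ⟩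
        a j * z * (y j * x j) ^ m j           ≡⟨ cong (λ p → p * (y j * x j) ^ m j) (*-comm (a j) z) ⟩
        z * a j * (y j * x j) ^ m j           ≡⟨ *-assoc _ _ _ ⟩
        z * (a j * (y j * x j) ^ m j)         ∎)
        (ΣF-*ˡ z (λ j → a j * (y j * x j) ^ m j))

    supp : Carrier → Carrier
    supp x with x ≟ 0#
    ... | yes _ = 0#
    ... | no _  = 1#

    -- For a unit the two powers cancel. At 0 the positive exponents make the right-hand factor
    -- vanish, whatever the inverse is.
    supp-power : ∀ x m h → 1 ℕ.≤ m → 1 ℕ.≤ h → ((x ^ m) ⁻¹) ^ h * x ^ (m ℕ.* h) ≡ supp x
    supp-power x m h 1≤m 1≤h with x ≟ 0#
    ... | yes refl = trans (cong ((((0# ^ m) ⁻¹) ^ h) *_) (0^n≡0 (ℕₚ.*-mono-≤ 1≤m 1≤h))) (zeroʳ _)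
    ... | no x≢0   = trans (cong ((((x ^ m) ⁻¹) ^ h) *_) (sym (^-assocʳ x m h))) ([x⁻¹]^n*x^n≡1 h (^≢0 m x≢0))

    averaged : ℤ → (Fin n → ℕ) → ℤ
    averaged κ h = ∑T n λ x → ∑T n λ v →
      weight ℤ.1ℤ v ℤ.* (weight κ x ℤ.* 𝟙 (ΣF (λ j → a j * (v j ^ h j * supp (x j))) ≟ 0#))

    -- Average the twists over all v in (F*)ⁿ and substitute v ↦ v / x^(m / h):
    -- what remains depends on x only through its support, hence not on m.
    count-average : ∀ κ {h m} (m′ : Fin n → ℕ) → (∀ j → m j ≡ m′ j ℕ.* h j) →
      (∀ j → 1 ℕ.≤ m′ j) → (∀ j → 1 ℕ.≤ h j) → PowersAbsorb h m →
      (q ℤ.- ℤ.1ℤ) ℤ.^ n ℤ.* count κ m ≡ averaged κ h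
    count-average κ {h} {m} m′ m≡m′h 1≤m′ 1≤h absorb = begin
      (q ℤ.- ℤ.1ℤ) ℤ.^ n ℤ.* count κ m
        ≡⟨ cong (ℤ._* count κ m) (sym (∑T-weight n ℤ.1ℤ)) ⟩
      ∑T n (weight ℤ.1ℤ) ℤ.* count κ m
        ≡⟨ sym (∑-*ʳ (allTuples n) (count κ m) (weight ℤ.1ℤ)) ⟩
      ∑T n (λ v → weight ℤ.1ℤ v ℤ.* count κ m)
        ≡⟨ ∑-cong (allTuples n) twist ⟩
      ∑T n (λ v → weight ℤ.1ℤ v ℤ.* ∑T n (λ x → term v x))
        ≡⟨ ∑-cong (allTuples n) (λ v → sym (∑-*ˡ (allTuples n) (weight ℤ.1ℤ v) _)) ⟩
      ∑T n (λ v → ∑T n (λ x → weight ℤ.1ℤ v ℤ.* term v x))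
        ≡⟨ ∑-swap (allTuples n) (allTuples n) _ ⟩
      ∑T n (λ x → ∑T n (λ v → weight ℤ.1ℤ v ℤ.* term v x))
        ≡⟨ ∑-cong (allTuples n) substitute ⟩
      averaged κ h ∎
      where
      open ≡-Reasoning
      term : (v x : Fin n → Carrier) → ℤ
      term v x = weight κ x ℤ.* 𝟙 (ΣF (λ j → a j * (v j ^ h j * x j ^ m j)) ≟ 0#)
      twist : ∀ v → weight ℤ.1ℤ v ℤ.* count κ m ≡ weight ℤ.1ℤ v ℤ.* ∑T n (λ x → term v x)
      twist v with weight-1 v
      ... | inj₁ (_ , w≡0)   = trans (cong (ℤ._* count κ m) w≡0) (sym (cong (ℤ._* ∑T n (λ x → term v x)) w≡0))
      ... | inj₂ (v≢0 , w≡1) = cong (λ s → weight ℤ.1ℤ v ℤ.* s) (count-twist κ {h} {m} absorb v v≢0)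
      substitute : ∀ x → ∑T n (λ v → weight ℤ.1ℤ v ℤ.* term v x) ≡ ∑T n (λ v →
        weight ℤ.1ℤ v ℤ.* (weight κ x ℤ.* 𝟙 (ΣF (λ j → a j * (v j ^ h j * supp (x j))) ≟ 0#)))
      substitute x = trans (sym (∑T-scale c≢0 (λ v → weight ℤ.1ℤ v ℤ.* term v x) ext)) (∑-cong (allTuples n) λ v →
        cong₂ (λ w s → w ℤ.* (weight κ x ℤ.* 𝟙 (s ≟ 0#))) (weight-scale ℤ.1ℤ v c≢0)
          (ΣF-cong λ j → cong (a j *_) (simplify v j)))
        where
        c : Fin n → Carrier
        -- Some `x j` may be 0. The default value of the inverse keeps `c j` a unit even then, so
        -- one substitution serves every support.
        c j = (x j ^ m′ j) ⁻¹
        c≢0 : ∀ j → c j ≢ 0#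
        c≢0 j = x⁻¹≢0 _
        ext : Extensional (λ v → weight ℤ.1ℤ v ℤ.* term v x)
        ext u≗v = cong₂ (λ w s → w ℤ.* (weight κ x ℤ.* 𝟙 (s ≟ 0#))) (weight-ext ℤ.1ℤ u≗v)
          (ΣF-cong λ j → cong (λ y → a j * (y ^ h j * x j ^ m j)) (u≗v j))
        simplify : ∀ v j → (c j * v j) ^ h j * x j ^ m j ≡ v j ^ h j * supp (x j)
        simplify v j = begin
          (c j * v j) ^ h j * x j ^ m j           ≡⟨ cong (λ e → (c j * v j) ^ h j * x j ^ e) (m≡m′h j) ⟩
          (c j * v j) ^ h j * x j ^ (m′ j ℕ.* h j) ≡⟨ cong (λ p → p * x j ^ (m′ j ℕ.* h j)) (trans (^-distribʳ-* (c j) (v j) (h j)) (*-comm _ _)) ⟩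
          v j ^ h j * c j ^ h j * x j ^ (m′ j ℕ.* h j) ≡⟨ *-assoc _ _ _ ⟩
          v j ^ h j * (c j ^ h j * x j ^ (m′ j ℕ.* h j)) ≡⟨ cong ((v j ^ h j) *_) (supp-power (x j) (m′ j) (h j) (1≤m′ j) (1≤h j)) ⟩
          v j ^ h j * supp (x j)                  ∎

-- Reduction to the zeros of the diagonal form

module Decomposition (F : FiniteField) where
  open FiniteField F
  open FieldProperties F
  open Tuples F

  weight-1-cong : ∀ {n} (x : Fin n → Carrier) {s t : ℤ} → ((∀ i → x i ≢ 0#) → s ≡ t) →
                  weight ℤ.1ℤ x ℤ.* s ≡ weight ℤ.1ℤ x ℤ.* t
  weight-1-cong x s≡t with weight-1 x
  ... | inj₁ (_ , w≡0)   rewrite w≡0 = refl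
  ... | inj₂ (x≢0 , _) rewrite s≡t x≢0 = refl

  ρ1-cong : ∀ x {s t : ℤ} → (x ≢ 0# → s ≡ t) → ρ ℤ.1ℤ x ℤ.* s ≡ ρ ℤ.1ℤ x ℤ.* t
  ρ1-cong x s≡t with x ≟ 0#
  ... | yes _  = refl
  ... | no x≢0 rewrite s≡t x≢0 = refl

  ^≡0⇒≡0 : ∀ x k → x ^ k ≡ 0# → x ≡ 0#
  ^≡0⇒≡0 x k eq with x ≟ 0#
  ... | yes x≡0 = x≡0
  ... | no x≢0  = ⊥-elim (^≢0 k x≢0 eq)

  ΠF-zero : ∀ {n} (f : Fin n → Carrier) i → f i ≡ 0# → ΠF f ≡ 0#
  ΠF-zero f zero    eq = trans (cong (_* ΠF (f ∘ suc)) eq) (zeroˡ _)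
  ΠF-zero f (suc i) eq = trans (cong (f zero *_) (ΠF-zero (f ∘ suc) i eq)) (zeroʳ _)

  module _ {n : ℕ} (a : Fin n → Carrier) (b : Carrier) (b≢0 : b ≢ 0#)
           (m : Fin n → ℕ) (k : ℕ) (1≤k : 1 ℕ.≤ k)
           (kk : Fin n → ℕ) (1≤kk : ∀ j → 1 ℕ.≤ kk j) where

    S P : (Fin n → Carrier) → Carrier
    S = diagonal a m
    P x = ΠF (λ j → x j ^ kk j)

    -- At units the right-hand side of the equation is nonzero, so S is nonzero at every solution.
    -- The middle factor records this, so that both sides are units whenever the term is rescaled.
    nonzeroTerm : (Fin n → Carrier) → ℤ
    nonzeroTerm x = weight ℤ.1ℤ x ℤ.* ((ℤ.1ℤ ℤ.- 𝟙 (S x ≟ 0#)) ℤ.* 𝟙 ((S x ^ k) ≟ (b * P x)))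

    nonzeroSolutions : ℤ
    nonzeroSolutions = ∑T n nonzeroTerm

    -- If some coordinate is 0, the equation reduces to S = 0 and only the first summand survives.
    -- At units the two indicators of S = 0 cancel and the last summand is the indicator of the
    -- equation.
    split-term : ∀ x → 𝟙 ((S x ^ k) ≟ (b * P x)) ≡
      weight ℤ.0ℤ x ℤ.* 𝟙 (S x ≟ 0#) ℤ.+ (ℤ.-1ℤ ℤ.* (weight ℤ.1ℤ x ℤ.* 𝟙 (S x ≟ 0#)) ℤ.+ nonzeroTerm x)
    split-term x rewrite weight-0 x with weight-1 x
    ... | inj₁ ((i , xᵢ≡0) , w≡0) rewrite w≡0 =
      trans (𝟙-cong _ (S x ≟ 0#) (λ eq → ^≡0⇒≡0 (S x) k (trans eq bP≡0))
              (λ eq → trans (trans (cong (_^ k) eq) (0^n≡0 1≤k)) (sym bP≡0)))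
            (trans (sym (ℤₚ.*-identityˡ _)) (sym (ℤₚ.+-identityʳ _)))
      where
      bP≡0 : b * P x ≡ 0#
      bP≡0 = trans (cong (b *_) (ΠF-zero _ i (trans (cong (_^ kk i) xᵢ≡0) (0^n≡0 (1≤kk i))))) (zeroʳ b)
    ... | inj₂ (x≢0 , w≡1) rewrite w≡1 with S x ≟ 0#
    ...   | yes Sx≡0 = 𝟙-no (_ ≟ _) λ eq →
            *≢0 b≢0 (ΠF≢0 λ j → ^≢0 (kk j) (x≢0 j)) (trans (sym eq) (trans (cong (_^ k) Sx≡0) (0^n≡0 1≤k)))
    ...   | no _     = regroup (𝟙 ((S x ^ k) ≟ (b * P x)))
      where
      regroup : ∀ i → i ≡ ℤ.1ℤ ℤ.* ℤ.0ℤ ℤ.+ (ℤ.-1ℤ ℤ.* (ℤ.1ℤ ℤ.* ℤ.0ℤ) ℤ.+ ℤ.1ℤ ℤ.* ((ℤ.1ℤ ℤ.- ℤ.0ℤ) ℤ.* i))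
      regroup = ℤSolver.solve-∀

    N-split : + N[ (λ x → S x ^ k) ≐ (λ x → b * P x) ] ≡
              count a ℤ.0ℤ m ℤ.- count a ℤ.1ℤ m ℤ.+ nonzeroSolutions
    N-split = begin
      + N[ (λ x → S x ^ k) ≐ (λ x → b * P x) ]
        ≡⟨ length-filter≡∑𝟙 (λ x → (S x ^ k) ≟ (b * P x)) (allTuples n) ⟩
      ∑T n (λ x → 𝟙 ((S x ^ k) ≟ (b * P x)))
        ≡⟨ ∑-cong (allTuples n) split-term ⟩
      ∑T n (λ x → weight ℤ.0ℤ x ℤ.* 𝟙 (S x ≟ 0#) ℤ.+ (ℤ.-1ℤ ℤ.* (weight ℤ.1ℤ x ℤ.* 𝟙 (S x ≟ 0#)) ℤ.+ nonzeroTerm x))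
        ≡⟨ ∑-+ (allTuples n) _ _ ⟩
      count a ℤ.0ℤ m ℤ.+ ∑T n (λ x → ℤ.-1ℤ ℤ.* (weight ℤ.1ℤ x ℤ.* 𝟙 (S x ≟ 0#)) ℤ.+ nonzeroTerm x)
        ≡⟨ cong (λ s → count a ℤ.0ℤ m ℤ.+ s) (trans (∑-+ (allTuples n) _ _)
             (cong (ℤ._+ nonzeroSolutions) (∑-*ˡ (allTuples n) ℤ.-1ℤ _))) ⟩
      count a ℤ.0ℤ m ℤ.+ (ℤ.-1ℤ ℤ.* count a ℤ.1ℤ m ℤ.+ nonzeroSolutions)
        ≡⟨ regroup (count a ℤ.0ℤ m) (count a ℤ.1ℤ m) nonzeroSolutions ⟩
      count a ℤ.0ℤ m ℤ.- count a ℤ.1ℤ m ℤ.+ nonzeroSolutions ∎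
      where
      open ≡-Reasoning
      regroup : ∀ x y z → x ℤ.+ (ℤ.-1ℤ ℤ.* y ℤ.+ z) ≡ x ℤ.- y ℤ.+ z
      regroup = ℤSolver.solve-∀

    module _ (M : ℕ) (e : Fin n → ℕ) (m*e≡M : ∀ j → m j ℕ.* e j ≡ M) where

      K = ΣN (λ j → kk j ℕ.* e j)

      -- With the weights `e j` = M / `m j` the diagonal form becomes homogeneous of degree `M`, and
      -- the monomial of degree `K`.
      _⊙_ : Carrier → (Fin n → Carrier) → Fin n → Carrier
      (u ⊙ x) j = u ^ e j * x j

      S-⊙ : ∀ u x → S (u ⊙ x) ≡ u ^ M * S x
      S-⊙ u x = trans (ΣF-cong λ j → begin
        a j * (u ^ e j * x j) ^ m j               ≡⟨ cong (a j *_) (^-distribʳ-* (u ^ e j) (x j) (m j)) ⟩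
        a j * ((u ^ e j) ^ m j * x j ^ m j)       ≡⟨ cong (λ p → a j * (p * x j ^ m j)) (^-assocʳ u (e j) (m j)) ⟩
        a j * (u ^ (e j ℕ.* m j) * x j ^ m j)     ≡⟨ cong (λ i → a j * (u ^ i * x j ^ m j)) (trans (ℕₚ.*-comm (e j) (m j)) (m*e≡M j)) ⟩
        a j * (u ^ M * x j ^ m j)                 ≡⟨ sym (*-assoc _ _ _) ⟩
        a j * u ^ M * x j ^ m j                   ≡⟨ cong (λ p → p * x j ^ m j) (*-comm (a j) (u ^ M)) ⟩
        u ^ M * a j * x j ^ m j                   ≡⟨ *-assoc _ _ _ ⟩
        u ^ M * (a j * x j ^ m j)                 ∎)
        (ΣF-*ˡ (u ^ M) (λ j → a j * x j ^ m j))
        where open ≡-Reasoning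

      P-⊙ : ∀ u x → P (u ⊙ x) ≡ u ^ K * P x
      P-⊙ u x = trans (ΠF-cong λ j → begin
        (u ^ e j * x j) ^ kk j            ≡⟨ ^-distribʳ-* (u ^ e j) (x j) (kk j) ⟩
        (u ^ e j) ^ kk j * x j ^ kk j     ≡⟨ cong (λ p → p * x j ^ kk j) (^-assocʳ u (e j) (kk j)) ⟩
        u ^ (e j ℕ.* kk j) * x j ^ kk j   ≡⟨ cong (λ i → u ^ i * x j ^ kk j) (ℕₚ.*-comm (e j) (kk j)) ⟩
        u ^ (kk j ℕ.* e j) * x j ^ kk j   ∎)
        (trans (ΠF-* (λ j → u ^ (kk j ℕ.* e j)) (λ j → x j ^ kk j))
               (cong (λ p → p * P x) (ΠF-^ u (λ j → kk j ℕ.* e j))))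
        where open ≡-Reasoning

      -- Double counting of the pairs (u, x) for which `u ⊙ x` is a solution in units. For fixed `u`
      -- the map x to `u ⊙ x` is a bijection, so each of the q - 1 units sees all solutions. For
      -- fixed `x` with `S x` nonzero, `uniqueScale` provides exactly one `u`.
      nonzeroSolutions-count :
        (∀ A B → A ≢ 0# → B ≢ 0# → ∑F (λ u → ρ ℤ.1ℤ u ℤ.* 𝟙 ((u ^ (k ℕ.* M) * A) ≟ (u ^ K * B))) ≡ ℤ.1ℤ) →
        (q ℤ.- ℤ.1ℤ) ℤ.* nonzeroSolutions ≡ (q ℤ.- ℤ.1ℤ) ℤ.^ n ℤ.- count a ℤ.1ℤ m
      nonzeroSolutions-count uniqueScale = begin
        (q ℤ.- ℤ.1ℤ) ℤ.* nonzeroSolutions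
          ≡⟨ cong (ℤ._* nonzeroSolutions) (sym (∑-ρ ℤ.1ℤ)) ⟩
        ∑F (ρ ℤ.1ℤ) ℤ.* nonzeroSolutions
          ≡⟨ sym (∑-*ʳ elements nonzeroSolutions (ρ ℤ.1ℤ)) ⟩
        ∑F (λ u → ρ ℤ.1ℤ u ℤ.* nonzeroSolutions)
          ≡⟨ ∑-cong elements (λ u → ρ1-cong u (rescale u)) ⟩
        ∑F (λ u → ρ ℤ.1ℤ u ℤ.* ∑T n (λ x → weight ℤ.1ℤ x ℤ.* (nz x ℤ.* sol u x)))
          ≡⟨ ∑-cong elements (λ u → sym (∑-*ˡ (allTuples n) (ρ ℤ.1ℤ u) _)) ⟩
        ∑F (λ u → ∑T n (λ x → ρ ℤ.1ℤ u ℤ.* (weight ℤ.1ℤ x ℤ.* (nz x ℤ.* sol u x))))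
          ≡⟨ ∑-swap elements (allTuples n) _ ⟩
        ∑T n (λ x → ∑F (λ u → ρ ℤ.1ℤ u ℤ.* (weight ℤ.1ℤ x ℤ.* (nz x ℤ.* sol u x))))
          ≡⟨ ∑-cong (allTuples n) (λ x → trans (∑-cong elements (λ u → move (ρ ℤ.1ℤ u) (weight ℤ.1ℤ x) (nz x) (sol u x)))
               (∑-*ˡ elements (weight ℤ.1ℤ x) _)) ⟩
        ∑T n (λ x → weight ℤ.1ℤ x ℤ.* ∑F (λ u → nz x ℤ.* (ρ ℤ.1ℤ u ℤ.* sol u x)))
          ≡⟨ ∑-cong (allTuples n) (λ x → weight-1-cong x (λ x≢0 → trans (∑-*ˡ elements (nz x) _) (one x x≢0))) ⟩
        ∑T n (λ x → weight ℤ.1ℤ x ℤ.* nz x)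
          ≡⟨ ∑-cong (allTuples n) (λ x → expand (weight ℤ.1ℤ x) (𝟙 (S x ≟ 0#))) ⟩
        ∑T n (λ x → weight ℤ.1ℤ x ℤ.+ ℤ.-1ℤ ℤ.* (weight ℤ.1ℤ x ℤ.* 𝟙 (S x ≟ 0#)))
          ≡⟨ trans (∑-+ (allTuples n) _ _) (cong₂ ℤ._+_ (∑T-weight n ℤ.1ℤ) (trans (∑-*ˡ (allTuples n) ℤ.-1ℤ _) (ℤₚ.-1*i≡-i _))) ⟩
        (q ℤ.- ℤ.1ℤ) ℤ.^ n ℤ.- count a ℤ.1ℤ m ∎
        where
        open ≡-Reasoning
        nz : (Fin n → Carrier) → ℤ
        nz x = ℤ.1ℤ ℤ.- 𝟙 (S x ≟ 0#)
        sol : Carrier → (Fin n → Carrier) → ℤ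
        sol u x = 𝟙 ((u ^ (k ℕ.* M) * S x ^ k) ≟ (u ^ K * (b * P x)))
        move : ∀ r w z s → r ℤ.* (w ℤ.* (z ℤ.* s)) ≡ w ℤ.* (z ℤ.* (r ℤ.* s))
        move = ℤSolver.solve-∀
        expand : ∀ w i → w ℤ.* (ℤ.1ℤ ℤ.- i) ≡ w ℤ.+ ℤ.-1ℤ ℤ.* (w ℤ.* i)
        expand = ℤSolver.solve-∀
        term-ext : Extensional nonzeroTerm
        term-ext {x} {y} x≗y = cong₂ ℤ._*_ (weight-ext ℤ.1ℤ x≗y)
          (cong₂ (λ s p → (ℤ.1ℤ ℤ.- 𝟙 (s ≟ 0#)) ℤ.* 𝟙 ((s ^ k) ≟ (b * p))) (diagonal-cong a m x≗y)
            (ΠF-cong λ j → cong (_^ kk j) (x≗y j)))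
        rescale : ∀ u → u ≢ 0# → nonzeroSolutions ≡ ∑T n (λ x → weight ℤ.1ℤ x ℤ.* (nz x ℤ.* sol u x))
        rescale u u≢0 = trans (sym (∑T-scale uᵉ≢0 nonzeroTerm term-ext)) (∑-cong (allTuples n) λ x →
          cong₂ ℤ._*_ (weight-scale ℤ.1ℤ x uᵉ≢0) (cong₂ (λ i j → (ℤ.1ℤ ℤ.- i) ℤ.* j)
            (𝟙-cong (S (u ⊙ x) ≟ 0#) (S x ≟ 0#)
              (λ eq → *-cancelˡ _ _ (^≢0 M u≢0) (trans (sym (S-⊙ u x)) (trans eq (sym (zeroʳ _)))))
              (λ eq → trans (S-⊙ u x) (trans (cong (u ^ M *_) eq) (zeroʳ _))))
            (cong₂ (λ s p → 𝟙 (s ≟ p)) (lhs x) (rhs x))))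
          where
          uᵉ≢0 : ∀ j → u ^ e j ≢ 0#
          uᵉ≢0 j = ^≢0 (e j) u≢0
          lhs : ∀ x → S (u ⊙ x) ^ k ≡ u ^ (k ℕ.* M) * S x ^ k
          lhs x = begin
            S (u ⊙ x) ^ k               ≡⟨ cong (_^ k) (S-⊙ u x) ⟩
            (u ^ M * S x) ^ k           ≡⟨ ^-distribʳ-* (u ^ M) (S x) k ⟩
            (u ^ M) ^ k * S x ^ k       ≡⟨ cong (λ p → p * S x ^ k) (trans (^-assocʳ u M k) (cong (u ^_) (ℕₚ.*-comm M k))) ⟩
            u ^ (k ℕ.* M) * S x ^ k     ∎
          rhs : ∀ x → b * P (u ⊙ x) ≡ u ^ K * (b * P x)
          rhs x = begin
            b * P (u ⊙ x)       ≡⟨ cong (b *_) (P-⊙ u x) ⟩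
            b * (u ^ K * P x)   ≡⟨ sym (*-assoc _ _ _) ⟩
            b * u ^ K * P x     ≡⟨ cong (_* P x) (*-comm b (u ^ K)) ⟩
            u ^ K * b * P x     ≡⟨ *-assoc _ _ _ ⟩
            u ^ K * (b * P x)   ∎
        one : ∀ x → (∀ i → x i ≢ 0#) → nz x ℤ.* ∑F (λ u → ρ ℤ.1ℤ u ℤ.* sol u x) ≡ nz x
        one x x≢0 with S x ≟ 0#
        ... | yes _   = refl
        ... | no Sx≢0 = trans (ℤₚ.*-identityˡ _)
          (uniqueScale (S x ^ k) (b * P x) (^≢0 k Sx≢0) (*≢0 b≢0 (ΠF≢0 λ j → ^≢0 (kk j) (x≢0 j))))

-- Powers in the multiplicative group

module Powers (F : FiniteField) where
  open FiniteField F
  open FieldProperties F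
  open Tuples F

  IsPower : ℕ → Carrier → Set
  IsPower d x = ∃ λ y → y ≢ 0# × x ≡ y ^ d

  IsPower-* : ∀ {d x y} → IsPower d x → IsPower d y → IsPower d (x * y)
  IsPower-* {d} (u , u≢0 , x≡) (v , v≢0 , y≡) =
    u * v , *≢0 u≢0 v≢0 , trans (cong₂ _*_ x≡ y≡) (sym (^-distribʳ-* u v d))

  IsPower-inverse : ∀ {d x} → IsPower d x → ∃ λ y → IsPower d y × x * y ≡ 1#
  IsPower-inverse {d} (u , u≢0 , x≡) = (u ⁻¹) ^ d , (u ⁻¹ , x⁻¹≢0 u , refl) ,
    trans (cong (λ p → p * (u ⁻¹) ^ d) x≡) (trans (*-comm _ _) ([x⁻¹]^n*x^n≡1 d u≢0))

  IsPower-∣ : ∀ {d e x} → d ∣ e → IsPower e x → IsPower d x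
  IsPower-∣ {d} (divides c refl) (u , u≢0 , x≡) = u ^ c , ^≢0 c u≢0 , trans x≡ (sym (^-assocʳ u c d))

  IsPower-ΠF : ∀ {n d} {r : Fin n → Carrier} → (∀ j → IsPower d (r j)) → IsPower d (ΠF r)
  IsPower-ΠF {zero}  {d} p = 1# , 1≢0 , sym (1^n≡1 d)
  IsPower-ΠF {suc n} {d} p = IsPower-* {d} (p zero) (IsPower-ΠF {n} {d} (p ∘ suc))

  -- The quotient of `r i` by the whole product is the inverse of the product of the other entries,
  -- all of which are `d`-th powers.
  ΠF-factor : ∀ {n d} {r : Fin n → Carrier} i → (∀ j → j ≢ i → IsPower d (r j)) →
              ∃ λ s → IsPower d s × ΠF r * s ≡ r i
  ΠF-factor {suc n} {d} {r} zero p with IsPower-inverse {d} (IsPower-ΠF {n} {d} {r ∘ suc} (λ j → p (suc j) λ ()))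
  ... | s , sPow , Πs≡1 = s , sPow , trans (*-assoc _ _ _) (trans (cong (r zero *_) Πs≡1) (*-identityʳ _))
  ΠF-factor {suc n} {d} {r} (suc i) p
    with ΠF-factor {n} {d} {r ∘ suc} i (λ j j≢i → p (suc j) (λ { refl → j≢i refl })) | IsPower-inverse {d} (p zero λ ())
  ... | s , sPow , Πs≡r | s₀ , s₀Pow , r₀s₀≡1 = s₀ * s , IsPower-* {d} s₀Pow sPow ,
    trans (*-interchange _ _ _ _) (trans (cong₂ _*_ r₀s₀≡1 Πs≡r) (*-identityˡ _))

  bézout-power : ∀ {x} g α d β e → x ≢ 0# → g ℕ.+ β ℕ.* e ≡ α ℕ.* d →
                 x ^ g ≡ (x ^ α) ^ d * ((x ⁻¹) ^ β) ^ e
  bézout-power {x} g α d β e x≢0 eq = sym (begin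
    (x ^ α) ^ d * ((x ⁻¹) ^ β) ^ e            ≡⟨ cong₂ _*_ (^-assocʳ x α d) (^-assocʳ (x ⁻¹) β e) ⟩
    x ^ (α ℕ.* d) * (x ⁻¹) ^ (β ℕ.* e)        ≡⟨ cong (λ i → x ^ i * (x ⁻¹) ^ (β ℕ.* e)) (sym eq) ⟩
    x ^ (g ℕ.+ β ℕ.* e) * (x ⁻¹) ^ (β ℕ.* e)  ≡⟨ cong (λ p → p * (x ⁻¹) ^ (β ℕ.* e)) (^-distribˡ-+ x g (β ℕ.* e)) ⟩
    x ^ g * x ^ (β ℕ.* e) * (x ⁻¹) ^ (β ℕ.* e) ≡⟨ *-assoc _ _ _ ⟩
    x ^ g * (x ^ (β ℕ.* e) * (x ⁻¹) ^ (β ℕ.* e)) ≡⟨ cong ((x ^ g) *_) (trans (*-comm _ _) ([x⁻¹]^n*x^n≡1 (β ℕ.* e) x≢0)) ⟩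
    x ^ g * 1#                                ≡⟨ *-identityʳ _ ⟩
    x ^ g                                     ∎)
    where open ≡-Reasoning

  -- Bézout's identity in the exponent. Its two forms differ in which multiple is the larger one,
  -- that is, in which of the two factors is built from the inverse of `x`.
  x^g-split : ∀ {x g d e} → x ≢ 0# → Bézout.Identity g d e →
              ∃ λ p → ∃ λ r → IsPower d p × IsPower e r × x ^ g ≡ p * r
  x^g-split {x} {g} {d} {e} x≢0 (Bézout.+- α β eq) =
    (x ^ α) ^ d , ((x ⁻¹) ^ β) ^ e , (x ^ α , ^≢0 α x≢0 , refl) , ((x ⁻¹) ^ β , ^≢0 β (x⁻¹≢0 x) , refl) ,
    bézout-power g α d β e x≢0 eq
  x^g-split {x} {g} {d} {e} x≢0 (Bézout.-+ α β eq) =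
    ((x ⁻¹) ^ α) ^ d , (x ^ β) ^ e , ((x ⁻¹) ^ α , ^≢0 α (x⁻¹≢0 x) , refl) , (x ^ β , ^≢0 β x≢0 , refl) ,
    trans (bézout-power g β e α d x≢0 eq) (*-comm _ _)

  bézout : ∀ {d e g} → gcd d e ≡ g → Bézout.Identity g d e
  bézout {d} {e} gcd≡g = subst (λ g → Bézout.Identity g d e) gcd≡g (Bézout.identity (gcd-GCD d e))

  -- Bézout splits a `g`-th power into an `m`-th power and a (q - 1)-th power, and the latter is 1
  -- by Fermat.
  IsPower-gcd : ∀ {m g x} → gcd m (size ℕ.∸ 1) ≡ g → IsPower g x → IsPower m x
  IsPower-gcd {m} {g} {x} gcd≡g (u , u≢0 , x≡) =
    let p , r , (y , y≢0 , p≡) , (w , w≢0 , r≡) , eq = x^g-split {u} {g} {m} {size ℕ.∸ 1} u≢0 (bézout gcd≡g)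
    in y , y≢0 , (begin
      x            ≡⟨ x≡ ⟩
      u ^ g        ≡⟨ eq ⟩
      p * r        ≡⟨ cong₂ _*_ p≡ (trans r≡ (fermat w≢0)) ⟩
      y ^ m * 1#   ≡⟨ *-identityʳ _ ⟩
      y ^ m        ∎)
    where open ≡-Reasoning

  module _ {n} (a : Fin n → Carrier) (h m d L : Fin n → ℕ)
           (split : ∀ i {x} → x ≢ 0# → ∃ λ p → ∃ λ r → IsPower (d i) p × IsPower (L i) r × x ^ h i ≡ p * r)
           (d-power⇒m-power : ∀ i {x} → IsPower (d i) x → IsPower (m i) x)
           (d∣L : ∀ i j → j ≢ i → d j ∣ L i) where

    -- Each `v i ^ h i` is `p i * r i` with `p i` a `d i`-th and `r i` an `L i`-th power. The common
    -- factor is the product of all `r j`. Dividing `r i` by it leaves the inverses of the `r j`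
    -- with j different from i. These are `d i`-th powers because `d i` divides `L j`, so together
    -- with `p i` they form a `d i`-th, hence an `m i`-th, power.
    powersAbsorb-split : PowersAbsorb a h m
    powersAbsorb-split v v≢0 = ΠF r , proj₁ ∘ y , ΠF≢0 r≢0 , proj₁ ∘ proj₂ ∘ y , (λ i → proj₂ (proj₂ (y i)))
      where
      open ≡-Reasoning
      vʰ : ∀ i → ∃ λ p → ∃ λ r → IsPower (d i) p × IsPower (L i) r × v i ^ h i ≡ p * r
      vʰ i = split i (v≢0 i)
      p r : Fin n → Carrier
      p i = proj₁ (vʰ i)
      r i = proj₁ (proj₂ (vʰ i))
      pPow : ∀ i → IsPower (d i) (p i)
      pPow i = proj₁ (proj₂ (proj₂ (vʰ i)))
      rPow : ∀ i → IsPower (L i) (r i)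
      rPow i = proj₁ (proj₂ (proj₂ (proj₂ (vʰ i))))
      vʰ≡pr : ∀ i → v i ^ h i ≡ p i * r i
      vʰ≡pr i = proj₂ (proj₂ (proj₂ (proj₂ (vʰ i))))
      r≢0 : ∀ i → r i ≢ 0#
      r≢0 i eq = let u , u≢0 , r≡ = rPow i in ^≢0 (L i) u≢0 (trans (sym r≡) eq)
      y : ∀ i → ∃ λ y → y ≢ 0# × v i ^ h i ≡ ΠF r * y ^ m i
      y i =
        let s , sPow , Πs≡r = ΠF-factor {n} {d i} {r} i (λ j j≢i → IsPower-∣ {d i} {L j} (d∣L j i (j≢i ∘ sym)) (rPow j))
            u , u≢0 , ps≡uᵐ = d-power⇒m-power i (IsPower-* {d i} (pPow i) sPow)
        in u , u≢0 , (begin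
          v i ^ h i             ≡⟨ vʰ≡pr i ⟩
          p i * r i             ≡⟨ cong (p i *_) (sym Πs≡r) ⟩
          p i * (ΠF r * s)      ≡⟨ sym (*-assoc _ _ _) ⟩
          p i * ΠF r * s        ≡⟨ cong (_* s) (*-comm (p i) (ΠF r)) ⟩
          ΠF r * p i * s        ≡⟨ *-assoc _ _ _ ⟩
          ΠF r * (p i * s)      ≡⟨ cong (ΠF r *_) ps≡uᵐ ⟩
          ΠF r * u ^ m i        ∎)

  powersAbsorb : ∀ {n} (a : Fin n → Carrier) (h m d L : Fin n → ℕ) →
    (∀ i → gcd (m i) (size ℕ.∸ 1) ≡ d i) → (∀ i → gcd (d i) (L i) ≡ h i) →
    (∀ i j → j ≢ i → d j ∣ L i) → PowersAbsorb a h m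
  powersAbsorb a h m d L gcd≡d gcd≡h = powersAbsorb-split a h m d L
    (λ i {x} x≢0 → x^g-split {x} {h i} {d i} {L i} x≢0 (bézout (gcd≡h i)))
    (λ i {x} → IsPower-gcd {m i} {d i} {x} (gcd≡d i))

  power≡1 : ∀ {y} e → y ^ e ≡ 1# → ∀ c → y ^ (c ℕ.* e) ≡ 1#
  power≡1 {y} e yᵉ≡1 c = trans (cong (y ^_) (ℕₚ.*-comm c e))
    (trans (sym (^-assocʳ y e c)) (trans (cong (_^ c) yᵉ≡1) (1^n≡1 c)))

  -- The order of `y` divides both `Δ` and q - 1. Bézout over the naturals presents this as two
  -- consecutive exponents that both send `y` to 1.
  coprime-kernel : ∀ {y Δ} → gcd Δ (size ℕ.∸ 1) ≡ 1 → y ≢ 0# → y ^ Δ ≡ 1# → y ≡ 1#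
  coprime-kernel {y} {Δ} gcd≡1 y≢0 yᐞ≡1 = go (bézout gcd≡1)
    where
    cancel : ∀ c e → y ^ c ≡ 1# → y ^ e ≡ 1# → suc c ≡ e → y ≡ 1#
    cancel c e yᶜ≡1 yᵉ≡1 eq =
      trans (sym (*-identityʳ y)) (trans (cong (y *_) (sym yᶜ≡1)) (trans (cong (y ^_) eq) yᵉ≡1))
    go : Bézout.Identity 1 Δ (size ℕ.∸ 1) → y ≡ 1#
    go (Bézout.+- α β eq) =
      cancel (β ℕ.* (size ℕ.∸ 1)) (α ℕ.* Δ) (power≡1 (size ℕ.∸ 1) (fermat y≢0) β) (power≡1 Δ yᐞ≡1 α) eq
    go (Bézout.-+ α β eq) =
      cancel (α ℕ.* Δ) (β ℕ.* (size ℕ.∸ 1)) (power≡1 Δ yᐞ≡1 α) (power≡1 (size ℕ.∸ 1) (fermat y≢0) β) eq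

  module _ {Δ : ℕ} (gcd≡1 : gcd Δ (size ℕ.∸ 1) ≡ 1) where

    root : ∀ {C} → C ≢ 0# → ∃ λ u → u ≢ 0# × C ≡ u ^ Δ
    root {C} C≢0 = IsPower-gcd {Δ} {1} {C} gcd≡1 (C , C≢0 , sym (*-identityʳ C))

    root-unique : ∀ {u w} → u ≢ 0# → w ≢ 0# → u ^ Δ ≡ w ^ Δ → u ≡ w
    root-unique {u} {w} u≢0 w≢0 eq = *-cancelˡ u w (x⁻¹≢0 w)
      (trans (coprime-kernel {w ⁻¹ * u} {Δ} gcd≡1 (*≢0 (x⁻¹≢0 w) u≢0)
        (trans (^-distribʳ-* (w ⁻¹) u Δ) (trans (cong (((w ⁻¹) ^ Δ) *_) eq) ([x⁻¹]^n*x^n≡1 Δ w≢0))))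
      (sym (x⁻¹*x≡1 w≢0)))

    -- Cancelling `u ^ K` leaves `u ^ Δ` = B / A, and raising to the power `Δ` is a bijection on the
    -- units.
    uniqueScale-+ : ∀ K {A B} → A ≢ 0# → B ≢ 0# →
      ∑F (λ u → ρ ℤ.1ℤ u ℤ.* 𝟙 ((u ^ (K ℕ.+ Δ) * A) ≟ (u ^ K * B))) ≡ ℤ.1ℤ
    uniqueScale-+ K {A} {B} A≢0 B≢0 with root (*≢0 B≢0 (x⁻¹≢0 A))
    ... | u₀ , u₀≢0 , C≡u₀ᐞ = trans (∑-single _ unique (complete u₀) elsewhere)
      (cong₂ ℤ._*_ (ρ1-≢0 u₀≢0) (𝟙-yes (_ ≟ _) holds))
      where
      open ≡-Reasoning
      expand : ∀ u → u ^ (K ℕ.+ Δ) * A ≡ u ^ K * (u ^ Δ * A)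
      expand u = trans (cong (_* A) (^-distribˡ-+ u K Δ)) (*-assoc _ _ _)
      B≡u₀ᐞA : B ≡ u₀ ^ Δ * A
      B≡u₀ᐞA = begin
        B               ≡⟨ sym (*-identityʳ B) ⟩
        B * 1#          ≡⟨ cong (B *_) (sym (x⁻¹*x≡1 A≢0)) ⟩
        B * (A ⁻¹ * A)  ≡⟨ sym (*-assoc _ _ _) ⟩
        B * A ⁻¹ * A    ≡⟨ cong (_* A) C≡u₀ᐞ ⟩
        u₀ ^ Δ * A      ∎
      holds : u₀ ^ (K ℕ.+ Δ) * A ≡ u₀ ^ K * B
      holds = trans (expand u₀) (cong ((u₀ ^ K) *_) (sym B≡u₀ᐞA))
      elsewhere : ∀ u → u ≢ u₀ → ρ ℤ.1ℤ u ℤ.* 𝟙 ((u ^ (K ℕ.+ Δ) * A) ≟ (u ^ K * B)) ≡ ℤ.0ℤ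
      elsewhere u u≢u₀ with u ≟ 0#
      ... | yes _  = refl
      ... | no u≢0 = trans (ℤₚ.*-identityˡ _) (𝟙-no (_ ≟ _) λ eq → u≢u₀ (root-unique u≢0 u₀≢0
        (*-cancelˡ _ _ A≢0 (trans (*-comm _ _) (trans
          (trans (*-cancelˡ _ _ (^≢0 K u≢0) (trans (sym (expand u)) eq)) B≡u₀ᐞA) (*-comm _ _))))))

  -- Only the absolute difference of the exponents enters the gcd. The smaller exponent is split off
  -- from the larger one; if that is `E`, the two sides of the equation change places.
  uniqueScale : ∀ E K → gcd ℤ.∣ + K ℤ.- + E ∣ (size ℕ.∸ 1) ≡ 1 → ∀ A B → A ≢ 0# → B ≢ 0# →
    ∑F (λ u → ρ ℤ.1ℤ u ℤ.* 𝟙 ((u ^ E * A) ≟ (u ^ K * B))) ≡ ℤ.1ℤ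
  uniqueScale E K gcd≡1 A B A≢0 B≢0 with ℕₚ.≤-total K E
  ... | inj₁ K≤E = subst (λ e → ∑F (λ u → ρ ℤ.1ℤ u ℤ.* 𝟙 ((u ^ e * A) ≟ (u ^ K * B))) ≡ ℤ.1ℤ)
    (ℕₚ.m+[n∸m]≡n K≤E) (uniqueScale-+ (subst (λ δ → gcd δ (size ℕ.∸ 1) ≡ 1)
      (trans (cong ℤ.∣_∣ (ℤₚ.m-n≡m⊖n K E)) (ℤₚ.∣⊖∣-≤ K≤E)) gcd≡1) K A≢0 B≢0)
  ... | inj₂ E≤K = trans (∑-cong elements λ u → cong (λ i → ρ ℤ.1ℤ u ℤ.* i) (𝟙-cong (_ ≟ _) (_ ≟ _) sym sym))
    (subst (λ e → ∑F (λ u → ρ ℤ.1ℤ u ℤ.* 𝟙 ((u ^ e * B) ≟ (u ^ E * A))) ≡ ℤ.1ℤ)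
    (ℕₚ.m+[n∸m]≡n E≤K) (uniqueScale-+ (subst (λ δ → gcd δ (size ℕ.∸ 1) ≡ 1)
      (trans (cong ℤ.∣_∣ (trans (ℤₚ.m-n≡m⊖n K E) (ℤₚ.⊖-≥ E≤K))) refl) gcd≡1) E B≢0 A≢0))

-- The quadratic character

module FieldSize (F : FiniteField) where
  open FiniteField F
  open FieldProperties F
  open Tuples F

  size∸1≢0 : size ℕ.∸ 1 ≢ 0
  size∸1≢0 eq with elements | complete 0# | complete 1#
  ... | _ ∷ []    | here refl | here refl = 0≢1 refl
  size∸1≢0 () | _ ∷ _ ∷ _ | _ | _

  +[size∸1]≡q-1 : + (size ℕ.∸ 1) ≡ q ℤ.- ℤ.1ℤ
  +[size∸1]≡q-1 = cong (λ s → + s ℤ.- ℤ.1ℤ) (sym size≡suc)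

  q-1≢0 : q ℤ.- ℤ.1ℤ ≢ ℤ.0ℤ
  q-1≢0 eq = size∸1≢0 (ℤₚ.+-injective (trans +[size∸1]≡q-1 eq))

  instance
    q-1-nonZero : ℤ.NonZero (q ℤ.- ℤ.1ℤ)
    q-1-nonZero = ℤ.≢-nonZero q-1≢0

    q-nonZero : ℤ.NonZero q
    q-nonZero = ℤ.≢-nonZero (size≢0 ∘ ℤₚ.+-injective)

  -- Convolution with `ψ` multiplies a function of sum 0 by q and annihilates constants.
  ψ : Carrier → ℤ
  ψ r = q ℤ.* 𝟙 (r ≟ 0#) ℤ.- ℤ.1ℤ

module QuadraticCharacter (F : FiniteField)
  (1+1≢0 : FiniteField._+_ F (FiniteField.1# F) (FiniteField.1# F) ≢ FiniteField.0# F) where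
  open FiniteField F
  open FieldProperties F
  open Tuples F
  open FieldSize F

  -- Ties each value of `η` to its evidence, so that later case distinctions need not unfold the
  -- nested decisions that define `η`.
  data ηView (x : Carrier) : Set where
    isZero      : x ≡ 0# → η x ≡ ℤ.0ℤ → ηView x
    isSquare    : ∀ y → y ≢ 0# → x ≡ y * y → η x ≡ ℤ.1ℤ → ηView x
    isNonSquare : x ≢ 0# → (∀ y → y * y ≢ x) → η x ≡ ℤ.-1ℤ → ηView x

  ηview : ∀ x → ηView x
  ηview x with x ≟ 0# in eq₁ | any? (λ y → (y * y) ≟ x) elements in eq₂
  ... | yes x≡0 | _ = isZero x≡0 ηx
    where
    ηx : η x ≡ ℤ.0ℤ
    ηx rewrite eq₁ = refl
  ... | no x≢0 | yes sq with satisfied sq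
  ...   | y , yy≡x = isSquare y (λ { refl → x≢0 (trans (sym yy≡x) (zeroˡ 0#)) }) (sym yy≡x) ηx
    where
    ηx : η x ≡ ℤ.1ℤ
    ηx rewrite eq₁ | eq₂ = refl
  ηview x | no x≢0 | no nsq = isNonSquare x≢0 (λ y yy≡x → nsq (lose (complete y) yy≡x)) ηx
    where
    ηx : η x ≡ ℤ.-1ℤ
    ηx rewrite eq₁ | eq₂ = refl

  η-0 : ∀ {x} → x ≡ 0# → η x ≡ ℤ.0ℤ
  η-0 {x} x≡0 with ηview x
  ... | isZero _ ηx         = ηx
  ... | isSquare y y≢0 x≡yy _ = ⊥-elim (*≢0 y≢0 y≢0 (trans (sym x≡yy) x≡0))
  ... | isNonSquare x≢0 _ _ = ⊥-elim (x≢0 x≡0)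

  η-square : ∀ {x} y → y ≢ 0# → x ≡ y * y → η x ≡ ℤ.1ℤ
  η-square {x} y y≢0 x≡yy with ηview x
  ... | isZero x≡0 _        = ⊥-elim (*≢0 y≢0 y≢0 (trans (sym x≡yy) x≡0))
  ... | isSquare _ _ _ ηx   = ηx
  ... | isNonSquare _ nsq _ = ⊥-elim (nsq y (sym x≡yy))

  η-nonSquare : ∀ {x} → x ≢ 0# → (∀ y → y * y ≢ x) → η x ≡ ℤ.-1ℤ
  η-nonSquare {x} x≢0 nsq with ηview x
  ... | isZero x≡0 _        = ⊥-elim (x≢0 x≡0)
  ... | isSquare y _ x≡yy _ = ⊥-elim (nsq y (sym x≡yy))
  ... | isNonSquare _ _ ηx  = ηx

  η≤1 : ∀ x → η x ℤ.≤ ℤ.1ℤ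
  η≤1 x with ηview x
  ... | isZero _ ηx        rewrite ηx = ℤ.+≤+ z≤n
  ... | isSquare _ _ _ ηx  rewrite ηx = ℤₚ.≤-refl
  ... | isNonSquare _ _ ηx rewrite ηx = ℤ.-≤+

  -y*y≡yy : ∀ y → - y * - y ≡ y * y
  -y*y≡yy y = trans (sym (-‿distribˡ-* y (- y)))
    (trans (cong -_ (sym (-‿distribʳ-* y y))) (-‿involutive (y * y)))

  square-roots : ∀ x y → x * x ≡ y * y → x ≢ y → x ≡ - y
  square-roots x y xx≡yy x≢y = +-cancelʳ y x (- y) (trans x+y≡0 (sym (-‿inverseˡ y)))
    where
    open ≡-Reasoning
    x-y≢0 : x + - y ≢ 0#
    x-y≢0 eq = x≢y (+-cancelʳ (- y) x y (trans eq (sym (-‿inverseʳ y))))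
    product≡0 : (x + - y) * (x + y) ≡ (x + - y) * 0#
    product≡0 = begin
      (x + - y) * (x + y)                       ≡⟨ distribʳ (x + y) x (- y) ⟩
      x * (x + y) + - y * (x + y)               ≡⟨ cong₂ _+_ (distribˡ x x y) (sym (-‿distribˡ-* y (x + y))) ⟩
      x * x + x * y + - (y * (x + y))           ≡⟨ cong (λ s → x * x + x * y + - s) (distribˡ y x y) ⟩
      x * x + x * y + - (y * x + y * y)         ≡⟨ cong₂ (λ s t → s + - t) (+-comm (x * x) (x * y)) (cong₂ _+_ (*-comm y x) (sym xx≡yy)) ⟩
      x * y + x * x + - (x * y + x * x)         ≡⟨ -‿inverseʳ _ ⟩
      0#                                        ≡⟨ sym (zeroʳ _) ⟩
      (x + - y) * 0#                            ∎
    x+y≡0 : x + y ≡ 0#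
    x+y≡0 = *-cancelˡ _ _ x-y≢0 product≡0

  -- This is where odd characteristic enters: nonzero squares have two distinct roots.
  y≢-y : ∀ {y} → y ≢ 0# → y ≢ - y
  y≢-y {y} y≢0 y≡-y = *≢0 y≢0 1+1≢0 (begin
    y * (1# + 1#)     ≡⟨ distribˡ y 1# 1# ⟩
    y * 1# + y * 1#   ≡⟨ cong₂ _+_ (trans (*-identityʳ y) y≡-y) (*-identityʳ y) ⟩
    - y + y           ≡⟨ -‿inverseˡ y ⟩
    0#                ∎)
    where open ≡-Reasoning

  ∑-𝟙-only : ∀ c → ∑F (λ x → 𝟙 (x ≟ c)) ≡ ℤ.1ℤ
  ∑-𝟙-only c = trans (∑-cong elements (λ x → sym (ℤₚ.*-identityʳ _))) (∑-𝟙 c (λ _ → ℤ.1ℤ))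

  count-square-roots : ∀ r → ∑F (λ x → 𝟙 ((x * x) ≟ r)) ≡ ℤ.1ℤ ℤ.+ η r
  count-square-roots r with ηview r
  ... | isZero r≡0 ηr = trans
    (trans (∑-cong elements (λ x → 𝟙-cong (_ ≟ r) (x ≟ 0#)
      (λ eq → square≡0 x (trans eq r≡0)) (λ eq → trans (trans (cong (_* x) eq) (zeroˡ x)) (sym r≡0))))
      (∑-𝟙-only 0#))
    (cong (λ e → ℤ.1ℤ ℤ.+ e) (sym ηr))
    where
    square≡0 : ∀ x → x * x ≡ 0# → x ≡ 0#
    square≡0 x eq with x ≟ 0#
    ... | yes x≡0 = x≡0
    ... | no x≢0  = ⊥-elim (*≢0 x≢0 x≢0 eq)
  ... | isSquare y y≢0 r≡yy ηr = trans
    (trans (∑-cong elements two) (trans (∑-+ elements _ _) (cong₂ ℤ._+_ (∑-𝟙-only y) (∑-𝟙-only (- y)))))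
    (cong (λ e → ℤ.1ℤ ℤ.+ e) (sym ηr))
    where
    two : ∀ x → 𝟙 ((x * x) ≟ r) ≡ 𝟙 (x ≟ y) ℤ.+ 𝟙 (x ≟ (- y))
    two x with x ≟ y | x ≟ (- y)
    ... | yes x≡y | yes x≡-y = ⊥-elim (y≢-y y≢0 (trans (sym x≡y) x≡-y))
    ... | yes x≡y | no _     = 𝟙-yes (_ ≟ r) (trans (cong₂ _*_ x≡y x≡y) (sym r≡yy))
    ... | no _    | yes x≡-y = 𝟙-yes (_ ≟ r) (trans (cong₂ _*_ x≡-y x≡-y) (trans (-y*y≡yy y) (sym r≡yy)))
    ... | no x≢y  | no x≢-y  = 𝟙-no (_ ≟ r) λ eq → x≢-y (square-roots x y (trans eq r≡yy) x≢y)
  ... | isNonSquare _ nsq ηr = trans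
    (trans (∑-cong elements (λ x → 𝟙-no (_ ≟ r) (nsq x))) (∑-0 elements))
    (cong (λ e → ℤ.1ℤ ℤ.+ e) (sym ηr))

  -- Sorting the q elements by their squares shows that the sum of 1 + η(r) over all r is q.
  ∑-η : ∑F η ≡ ℤ.0ℤ
  ∑-η = ℤ+-cancelˡ q _ _ (begin
    q ℤ.+ ∑F η                                ≡⟨ cong (ℤ._+ ∑F η) (sym (trans (∑-const elements ℤ.1ℤ) (ℤₚ.*-identityʳ q))) ⟩
    ∑F (λ _ → ℤ.1ℤ) ℤ.+ ∑F η                  ≡⟨ sym (∑-+ elements _ _) ⟩
    ∑F (λ r → ℤ.1ℤ ℤ.+ η r)                   ≡⟨ ∑-cong elements (λ r → sym (count-square-roots r)) ⟩
    ∑F (λ r → ∑F (λ x → 𝟙 ((x * x) ≟ r)))     ≡⟨ ∑-swap elements elements _ ⟩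
    ∑F (λ x → ∑F (λ r → 𝟙 ((x * x) ≟ r)))     ≡⟨ ∑-cong elements (λ x → trans (∑-cong elements (λ r → 𝟙-cong (_ ≟ _) (_ ≟ _) sym sym)) (∑-𝟙-only (x * x))) ⟩
    ∑F (λ _ → ℤ.1ℤ)                           ≡⟨ trans (∑-const elements ℤ.1ℤ) (ℤₚ.*-identityʳ q) ⟩
    q                                         ≡⟨ sym (ℤₚ.+-identityʳ q) ⟩
    q ℤ.+ ℤ.0ℤ                                ∎)
    where open ≡-Reasoning

  η-*-square : ∀ y r → y ≢ 0# → η (y * y * r) ≡ η r
  η-*-square y r y≢0 with ηview r
  ... | isZero r≡0 ηr = trans (η-0 (trans (cong (y * y *_) r≡0) (zeroʳ _))) (sym ηr)
  ... | isSquare w w≢0 r≡ww ηr = trans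
    (η-square (y * w) (*≢0 y≢0 w≢0) (trans (cong (y * y *_) r≡ww) (*-interchange y y w w))) (sym ηr)
  ... | isNonSquare r≢0 nsq ηr = trans (η-nonSquare (*≢0 (*≢0 y≢0 y≢0) r≢0) λ z zz≡yyr →
    nsq (y ⁻¹ * z) (trans (*-interchange _ _ _ _) (trans (cong (y ⁻¹ * y ⁻¹ *_) zz≡yyr)
      (trans (sym (*-assoc _ _ r)) (trans (cong (_* r) (trans (*-interchange _ _ _ _)
        (trans (cong₂ _*_ (x⁻¹*x≡1 y≢0) (x⁻¹*x≡1 y≢0)) (*-identityˡ 1#)))) (*-identityˡ r)))))) (sym ηr)

  -- η (g r) + η r is never positive and sums to 0, hence vanishes.
  η-*-nonSquare : ∀ g r → η g ≡ ℤ.-1ℤ → g ≢ 0# → η (g * r) ≡ ℤ.- η r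
  η-*-nonSquare g r ηg g≢0 = begin
    η (g * r)                         ≡⟨ regroup (η (g * r)) (η r) ⟩
    (η (g * r) ℤ.+ η r) ℤ.- η r       ≡⟨ cong (ℤ._- η r) (∑≡0∧≤0⇒≡0 nonpositive total (complete r)) ⟩
    ℤ.0ℤ ℤ.- η r                      ≡⟨ ℤₚ.+-identityˡ _ ⟩
    ℤ.- η r                           ∎
    where
    open ≡-Reasoning
    regroup : ∀ x y → x ≡ (x ℤ.+ y) ℤ.- y
    regroup = ℤSolver.solve-∀
    total : ∑F (λ r → η (g * r) ℤ.+ η r) ≡ ℤ.0ℤ
    total = trans (∑-+ elements _ _) (cong₂ ℤ._+_ (trans (∑-scale g≢0 η) ∑-η) ∑-η)
    nonpositive : ∀ r → η (g * r) ℤ.+ η r ℤ.≤ ℤ.0ℤ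
    nonpositive r with ηview r
    ... | isZero r≡0 ηr = ℤₚ.≤-reflexive (cong₂ ℤ._+_ (η-0 (trans (cong (g *_) r≡0) (zeroʳ g))) ηr)
    ... | isSquare w w≢0 r≡ww ηr = ℤₚ.≤-reflexive (cong₂ ℤ._+_
      (trans (cong η (trans (cong (g *_) r≡ww) (*-comm g _))) (trans (η-*-square w g w≢0) ηg)) ηr)
    ... | isNonSquare _ _ ηr rewrite ηr = ℤₚ.+-monoˡ-≤ ℤ.-1ℤ (η≤1 (g * r))

  η-* : ∀ x y → η (x * y) ≡ η x ℤ.* η y
  η-* x y with ηview x
  ... | isZero x≡0 ηx rewrite ηx = η-0 (trans (cong (_* y) x≡0) (zeroˡ y))
  ... | isSquare w w≢0 x≡ww ηx rewrite ηx =
    trans (cong (λ z → η (z * y)) x≡ww) (trans (η-*-square w y w≢0) (sym (ℤₚ.*-identityˡ _)))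
  ... | isNonSquare x≢0 _ ηx =
    trans (η-*-nonSquare x y ηx x≢0) (trans (sym (ℤₚ.-1*i≡-i _)) (cong (ℤ._* η y) (sym ηx)))

  η-1 : η 1# ≡ ℤ.1ℤ
  η-1 = η-square 1# 1≢0 (sym (*-identityˡ 1#))

  η-^ : ∀ x n → η (x ^ n) ≡ η x ℤ.^ n
  η-^ x zero    = η-1
  η-^ x (suc n) = trans (η-* x (x ^ n)) (cong (λ s → η x ℤ.* s) (η-^ x n))

  η*η : ∀ x → η x ℤ.* η x ≡ ρ ℤ.1ℤ x
  η*η x with ηview x
  ... | isZero x≡0 ηx      rewrite ηx = sym (ρ1-0 x≡0)
  ... | isSquare y y≢0 x≡yy ηx rewrite ηx = sym (ρ1-≢0 (λ x≡0 → *≢0 y≢0 y≢0 (trans (sym x≡yy) x≡0)))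
  ... | isNonSquare x≢0 _ ηx rewrite ηx = sym (ρ1-≢0 x≢0)

  η-⁻¹ : ∀ {a} → a ≢ 0# → η (a ⁻¹) ≡ η a
  η-⁻¹ {a} a≢0 = trans (cong η (sym (trans (*-assoc _ _ a)
    (trans (cong (a ⁻¹ *_) (x⁻¹*x≡1 a≢0)) (*-identityʳ _))))) (η-*-square (a ⁻¹) a (x⁻¹≢0 a))

  η-negate : ∀ s → η (- s) ≡ η (- 1#) ℤ.* η s
  η-negate s = trans (cong η (sym (-1*x≈-x s))) (η-* (- 1#) s)

  -- The convolution of `η` with itself; `J 1#` is the Jacobi sum of `η` and `η`.
  J : Carrier → ℤ
  J r = ∑F (λ s → η s ℤ.* η (r + - s))

  J-0 : J 0# ≡ η (- 1#) ℤ.* (q ℤ.- ℤ.1ℤ)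
  J-0 = begin
    J 0#                                  ≡⟨ ∑-cong elements (λ s → cong (λ z → η s ℤ.* z) (trans (cong η (+-identityˡ (- s))) (η-negate s))) ⟩
    ∑F (λ s → η s ℤ.* (η (- 1#) ℤ.* η s)) ≡⟨ ∑-cong elements (λ s → trans (move (η s) (η (- 1#))) (cong (λ z → η (- 1#) ℤ.* z) (η*η s))) ⟩
    ∑F (λ s → η (- 1#) ℤ.* ρ ℤ.1ℤ s)      ≡⟨ ∑-*ˡ elements (η (- 1#)) (ρ ℤ.1ℤ) ⟩
    η (- 1#) ℤ.* ∑F (ρ ℤ.1ℤ)              ≡⟨ cong (λ z → η (- 1#) ℤ.* z) (∑-ρ ℤ.1ℤ) ⟩
    η (- 1#) ℤ.* (q ℤ.- ℤ.1ℤ)             ∎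
    where
    open ≡-Reasoning
    move : ∀ x y → x ℤ.* (y ℤ.* x) ≡ y ℤ.* (x ℤ.* x)
    move = ℤSolver.solve-∀

  -- The substitution of `u * s` for `s` takes out the factor η(u) twice, and its square is 1.
  J-unit : ∀ u → u ≢ 0# → J u ≡ J 1#
  J-unit u u≢0 = trans (sym (∑-scale u≢0 (λ s → η s ℤ.* η (u + - s)))) (∑-cong elements λ s → begin
    η (u * s) ℤ.* η (u + - (u * s))                   ≡⟨ cong (λ z → η (u * s) ℤ.* η z) (factor s) ⟩
    η (u * s) ℤ.* η (u * (1# + - s))                  ≡⟨ cong₂ ℤ._*_ (η-* u s) (η-* u _) ⟩
    (η u ℤ.* η s) ℤ.* (η u ℤ.* η (1# + - s))          ≡⟨ move (η u) (η s) (η (1# + - s)) ⟩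
    (η u ℤ.* η u) ℤ.* (η s ℤ.* η (1# + - s))          ≡⟨ cong (ℤ._* (η s ℤ.* η (1# + - s))) (trans (η*η u) (ρ1-≢0 u≢0)) ⟩
    ℤ.1ℤ ℤ.* (η s ℤ.* η (1# + - s))                   ≡⟨ ℤₚ.*-identityˡ _ ⟩
    η s ℤ.* η (1# + - s)                              ∎)
    where
    open ≡-Reasoning
    factor : ∀ s → u + - (u * s) ≡ u * (1# + - s)
    factor s = sym (trans (distribˡ u 1# (- s)) (cong₂ _+_ (*-identityʳ u) (sym (-‿distribʳ-* u s))))
    move : ∀ x y z → (x ℤ.* y) ℤ.* (x ℤ.* z) ≡ (x ℤ.* x) ℤ.* (y ℤ.* z)
    move = ℤSolver.solve-∀

  ∑-J : ∑F J ≡ ℤ.0ℤ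
  ∑-J = begin
    ∑F (λ r → ∑F (λ s → η s ℤ.* η (r + - s)))   ≡⟨ ∑-swap elements elements _ ⟩
    ∑F (λ s → ∑F (λ r → η s ℤ.* η (r + - s)))   ≡⟨ ∑-cong elements (λ s → trans (∑-*ˡ elements (η s) _) (trans
      (cong (λ z → η s ℤ.* z) (trans (∑-cong elements (λ r → cong η (+-comm r (- s)))) (trans (∑-shift (- s) η) ∑-η)))
      (ℤₚ.*-zeroʳ (η s)))) ⟩
    ∑F (λ _ → ℤ.0ℤ)                             ≡⟨ ∑-0 elements ⟩
    ℤ.0ℤ                                        ∎
    where open ≡-Reasoning

  -- J is constant off 0 and sums to 0, so J 1 is determined by J 0.
  J-1 : J 1# ≡ ℤ.- η (- 1#)
  J-1 = ℤₚ.*-cancelˡ-≡ (q ℤ.- ℤ.1ℤ) _ _ (begin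
    (q ℤ.- ℤ.1ℤ) ℤ.* J 1#                                       ≡⟨ regroup q (J 0#) (J 1#) ⟩
    (J 0# ℤ.- J 1#) ℤ.+ q ℤ.* J 1# ℤ.- J 0#                     ≡⟨ cong (ℤ._- J 0#) (trans (sym total) ∑-J) ⟩
    ℤ.0ℤ ℤ.- J 0#                                               ≡⟨ cong (λ z → ℤ.0ℤ ℤ.- z) J-0 ⟩
    ℤ.0ℤ ℤ.- η (- 1#) ℤ.* (q ℤ.- ℤ.1ℤ)                          ≡⟨ finish (η (- 1#)) (q ℤ.- ℤ.1ℤ) ⟩
    (q ℤ.- ℤ.1ℤ) ℤ.* (ℤ.- η (- 1#))                             ∎)
    where
    open ≡-Reasoning
    regroup : ∀ q x y → (q ℤ.- ℤ.1ℤ) ℤ.* y ≡ (x ℤ.- y) ℤ.+ q ℤ.* y ℤ.- x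
    regroup = ℤSolver.solve-∀
    finish : ∀ w p → ℤ.0ℤ ℤ.- w ℤ.* p ≡ p ℤ.* (ℤ.- w)
    finish = ℤSolver.solve-∀
    pointwise : ∀ r → J r ≡ 𝟙 (r ≟ 0#) ℤ.* (J 0# ℤ.- J 1#) ℤ.+ J 1#
    pointwise r with r ≟ 0#
    ... | yes r≡0 = trans (cong J r≡0) (split (J 0#) (J 1#))
      where
      split : ∀ x y → x ≡ ℤ.1ℤ ℤ.* (x ℤ.- y) ℤ.+ y
      split = ℤSolver.solve-∀
    ... | no r≢0  = trans (J-unit r r≢0) (sym (ℤₚ.+-identityˡ _))
    total : ∑F J ≡ (J 0# ℤ.- J 1#) ℤ.+ q ℤ.* J 1#
    total = trans (∑-cong elements pointwise) (trans (∑-+ elements _ _)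
      (cong₂ ℤ._+_ (∑-𝟙 0# (λ _ → J 0# ℤ.- J 1#)) (∑-const elements (J 1#))))

  η-convolution : ∀ r → ∑F (λ s → η s ℤ.* η (r + - s)) ≡ η (- 1#) ℤ.* ψ r
  η-convolution r with r ≟ 0#
  ... | yes r≡0 = trans (cong J r≡0) (trans J-0 (cong (λ z → η (- 1#) ℤ.* (z ℤ.- ℤ.1ℤ)) (sym (ℤₚ.*-identityʳ q))))
  ... | no r≢0  = trans (J-unit r r≢0) (trans J-1 (finish (η (- 1#)) q))
    where
    finish : ∀ w q → ℤ.- w ≡ w ℤ.* (q ℤ.* ℤ.0ℤ ℤ.- ℤ.1ℤ)
    finish = ℤSolver.solve-∀

  count-ax² : ∀ {a} → a ≢ 0# → ∀ s → ∑F (λ x → 𝟙 ((a * x ^ 2) ≟ s)) ≡ ℤ.1ℤ ℤ.+ η a ℤ.* η s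
  count-ax² {a} a≢0 s = begin
    ∑F (λ x → 𝟙 ((a * x ^ 2) ≟ s))        ≡⟨ ∑-cong elements (λ x → 𝟙-cong (_ ≟ _) (_ ≟ _)
      (λ eq → trans (sym (x⁻¹*[x*y]≡y (x * x) a≢0)) (cong (a ⁻¹ *_) (trans (cong (λ z → a * (x * z)) (sym (*-identityʳ x))) eq)))
      (λ eq → trans (cong (λ z → a * (x * z)) (*-identityʳ x)) (trans (cong (a *_) eq) (x*[x⁻¹*y]≡y s a≢0)))) ⟩
    ∑F (λ x → 𝟙 ((x * x) ≟ (a ⁻¹ * s)))   ≡⟨ count-square-roots (a ⁻¹ * s) ⟩
    ℤ.1ℤ ℤ.+ η (a ⁻¹ * s)                 ≡⟨ cong (λ z → ℤ.1ℤ ℤ.+ z) (trans (η-* (a ⁻¹) s) (cong (ℤ._* η s) (η-⁻¹ a≢0))) ⟩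
    ℤ.1ℤ ℤ.+ η a ℤ.* η s                  ∎
    where open ≡-Reasoning

-- Linear and quadratic diagonal forms

module _ (w : ℤ) where

  -- (A , B) are the coefficients of ψ / q and χ in the convolution of the functions ε χ - κ ψ / q,
  -- where ψ / q is a unit for the convolution and χ * χ = w ψ / q.
  A B : ℤ → List ℤ → ℤ
  A κ []       = ℤ.1ℤ
  A κ (ε ∷ εs) = ε ℤ.* w ℤ.* B κ εs ℤ.- κ ℤ.* A κ εs
  B κ []       = ℤ.0ℤ
  B κ (ε ∷ εs) = ε ℤ.* A κ εs ℤ.- κ ℤ.* B κ εs

∑-linear : ∀ {X : Set} (xs : List X) c f g →
           ∑ xs (λ x → c ℤ.* f x ℤ.+ g x) ≡ c ℤ.* ∑ xs f ℤ.+ ∑ xs g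
∑-linear xs c f g = trans (∑-+ xs _ g) (cong (ℤ._+ ∑ xs g) (∑-*ˡ xs c f))

-- `χ` is kept abstract to cover two situations. If a quadratic term occurs, q is odd, `χ` is `η`
-- and `ω` is η(-1). If all terms are linear, q may be even and `η` need not sum to 0; then `χ` and
-- `ω` are taken to be 0.
module DiagonalCount (F : FiniteField) (χ : FiniteField.Carrier F → ℤ) (ω : ℤ) where
  open FiniteField F
  open FieldProperties F
  open Tuples F
  open FieldSize F

  module _ (∑-χ : ∑F χ ≡ ℤ.0ℤ) (χ-convolution : ∀ r → ∑F (λ s → χ s ℤ.* χ (r + - s)) ≡ ω ℤ.* ψ r) where

    -- Describes the fibre over `s` of the map from x to a x^h. For h = 1 the coefficient `ε` is 0,
    -- for h = 2 it is `χ a`. The last term removes x = 0 when `κ` is 1.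
    HasFibres : ℤ → Carrier → ℕ → ℤ → Set
    HasFibres κ a h ε =
      ∀ s → ∑F (λ x → ρ κ x ℤ.* 𝟙 ((a * x ^ h) ≟ s)) ≡ ℤ.1ℤ ℤ.+ ε ℤ.* χ s ℤ.- κ ℤ.* 𝟙 (s ≟ 0#)

    pushforward : ∀ (u : Carrier → ℤ) (y : Carrier → Carrier) (G : Carrier → ℤ) →
      ∑F (λ x → u x ℤ.* G (y x)) ≡ ∑F (λ s → ∑F (λ x → u x ℤ.* 𝟙 (y x ≟ s)) ℤ.* G s)
    pushforward u y G = sym (begin
      ∑F (λ s → ∑F (λ x → u x ℤ.* 𝟙 (y x ≟ s)) ℤ.* G s)
        ≡⟨ ∑-cong elements (λ s → sym (∑-*ʳ elements (G s) _)) ⟩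
      ∑F (λ s → ∑F (λ x → u x ℤ.* 𝟙 (y x ≟ s) ℤ.* G s))
        ≡⟨ ∑-swap elements elements _ ⟩
      ∑F (λ x → ∑F (λ s → u x ℤ.* 𝟙 (y x ≟ s) ℤ.* G s))
        ≡⟨ ∑-cong elements (λ x → trans
             (∑-cong elements (λ s → trans (ℤₚ.*-assoc (u x) _ _)
               (cong (λ i → u x ℤ.* (i ℤ.* G s)) (𝟙-cong (y x ≟ s) (s ≟ y x) sym sym))))
             (trans (∑-*ˡ elements (u x) _) (cong (λ z → u x ℤ.* z) (∑-𝟙 (y x) G)))) ⟩
      ∑F (λ x → u x ℤ.* G (y x)) ∎)
      where open ≡-Reasoning

    ∑-ψ : ∑F ψ ≡ ℤ.0ℤ
    ∑-ψ = begin
      ∑F (λ r → q ℤ.* 𝟙 (r ≟ 0#) ℤ.- ℤ.1ℤ)            ≡⟨ ∑-linear elements q _ _ ⟩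
      q ℤ.* ∑F (λ r → 𝟙 (r ≟ 0#)) ℤ.+ ∑F (λ _ → ℤ.-1ℤ) ≡⟨ cong₂ (λ x y → q ℤ.* x ℤ.+ y)
        (trans (∑-cong elements (λ r → sym (ℤₚ.*-identityʳ _))) (∑-𝟙 0# (λ _ → ℤ.1ℤ))) (∑-const elements ℤ.-1ℤ) ⟩
      q ℤ.* ℤ.1ℤ ℤ.+ q ℤ.* ℤ.-1ℤ                       ≡⟨ cancel q ⟩
      ℤ.0ℤ                                             ∎
      where
      open ≡-Reasoning
      cancel : ∀ q → q ℤ.* ℤ.1ℤ ℤ.+ q ℤ.* ℤ.-1ℤ ≡ ℤ.0ℤ
      cancel = ℤSolver.solve-∀

    r-s≡0⇒s≡r : ∀ r s → r + - s ≡ 0# → s ≡ r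
    r-s≡0⇒s≡r r s eq = sym (+-cancelʳ (- s) r s (trans eq (sym (-‿inverseʳ s))))

    -- As `χ` sums to 0, only the delta part of `ψ` acts on it.
    χ*ψ : ∀ r → ∑F (λ s → χ s ℤ.* ψ (r + - s)) ≡ q ℤ.* χ r
    χ*ψ r = begin
      ∑F (λ s → χ s ℤ.* (q ℤ.* 𝟙 ((r + - s) ≟ 0#) ℤ.- ℤ.1ℤ))
        ≡⟨ ∑-cong elements (λ s → trans (expand (χ s) q (𝟙 ((r + - s) ≟ 0#)))
             (cong (λ i → q ℤ.* (i ℤ.* χ s) ℤ.+ ℤ.-1ℤ ℤ.* χ s) (𝟙-cong (_ ≟ 0#) (s ≟ r)
               (r-s≡0⇒s≡r r s) (λ s≡r → trans (cong (λ z → r + - z) s≡r) (-‿inverseʳ r))))) ⟩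
      ∑F (λ s → q ℤ.* (𝟙 (s ≟ r) ℤ.* χ s) ℤ.+ ℤ.-1ℤ ℤ.* χ s)
        ≡⟨ trans (∑-linear elements q _ _) (cong₂ (λ x y → q ℤ.* x ℤ.+ y) (∑-𝟙 r χ) (∑-*ˡ elements ℤ.-1ℤ χ)) ⟩
      q ℤ.* χ r ℤ.+ ℤ.-1ℤ ℤ.* ∑F χ
        ≡⟨ trans (cong (λ z → q ℤ.* χ r ℤ.+ ℤ.-1ℤ ℤ.* z) ∑-χ) (ℤₚ.+-identityʳ _) ⟩
      q ℤ.* χ r ∎
      where
      open ≡-Reasoning
      expand : ∀ x q i → x ℤ.* (q ℤ.* i ℤ.- ℤ.1ℤ) ≡ q ℤ.* (i ℤ.* x) ℤ.+ ℤ.-1ℤ ℤ.* x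
      expand = ℤSolver.solve-∀

    -- This is q times the number of tuples with value `r`: the even share `Q` / q corrected by `α`
    -- times `ψ` / q and by `β` times `χ`.
    profile : (Q α β : ℤ) → Carrier → ℤ
    profile Q α β r = Q ℤ.+ α ℤ.* ψ r ℤ.+ q ℤ.* (β ℤ.* χ r)

    -- Multiplication table: constants annihilate `ψ` and `χ`, `χ` with `χ` gives `ω` `ψ`, `χ` with
    -- `ψ` gives q `χ`, and the delta at 0 is the unit. The new coefficients are one step of the
    -- recursion for `A` and `B` at w = `ω` q.
    convolve-profile : ∀ κ ε Q α β r →
      ∑F (λ s → (ℤ.1ℤ ℤ.+ ε ℤ.* χ s ℤ.- κ ℤ.* 𝟙 (s ≟ 0#)) ℤ.* profile Q α β (r + - s)) ≡
      (q ℤ.- κ) ℤ.* Q ℤ.+ (ε ℤ.* (ω ℤ.* q) ℤ.* β ℤ.- κ ℤ.* α) ℤ.* ψ r ℤ.+ q ℤ.* ((ε ℤ.* α ℤ.- κ ℤ.* β) ℤ.* χ r)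
    convolve-profile κ ε Q α β r = begin
      ∑F (λ s → (ℤ.1ℤ ℤ.+ ε ℤ.* χ s ℤ.- κ ℤ.* 𝟙 (s ≟ 0#)) ℤ.* profile Q α β (r + - s))
        ≡⟨ ∑-cong elements (λ s → expand ε (χ s) κ (𝟙 (s ≟ 0#)) Q α (ψ (r + - s)) q β (χ (r + - s))) ⟩
      ∑F (λ s → α ℤ.* ψ (r + - s) ℤ.+ (q ℤ.* β ℤ.* χ (r + - s) ℤ.+ (ε ℤ.* Q ℤ.* χ s ℤ.+ (ε ℤ.* α ℤ.* (χ s ℤ.* ψ (r + - s))
           ℤ.+ (ε ℤ.* q ℤ.* β ℤ.* (χ s ℤ.* χ (r + - s)) ℤ.+ (ℤ.- κ ℤ.* (𝟙 (s ≟ 0#) ℤ.* profile Q α β (r + - s)) ℤ.+ Q))))))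
        ≡⟨ step α _ (∑-reflect r ψ) (step (q ℤ.* β) _ (∑-reflect r χ) (step (ε ℤ.* Q) _ refl (step (ε ℤ.* α) _ (χ*ψ r)
             (step (ε ℤ.* q ℤ.* β) _ (χ-convolution r) (step (ℤ.- κ) _ at0 (∑-const elements Q)))))) ⟩
      α ℤ.* ∑F ψ ℤ.+ (q ℤ.* β ℤ.* ∑F χ ℤ.+ (ε ℤ.* Q ℤ.* ∑F χ ℤ.+ (ε ℤ.* α ℤ.* (q ℤ.* χ r)
           ℤ.+ (ε ℤ.* q ℤ.* β ℤ.* (ω ℤ.* ψ r) ℤ.+ (ℤ.- κ ℤ.* profile Q α β r ℤ.+ q ℤ.* Q)))))
        ≡⟨ cong₂ (λ x y → α ℤ.* x ℤ.+ (q ℤ.* β ℤ.* y ℤ.+ (ε ℤ.* Q ℤ.* y ℤ.+ (ε ℤ.* α ℤ.* (q ℤ.* χ r)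
             ℤ.+ (ε ℤ.* q ℤ.* β ℤ.* (ω ℤ.* ψ r) ℤ.+ (ℤ.- κ ℤ.* profile Q α β r ℤ.+ q ℤ.* Q)))))) ∑-ψ ∑-χ ⟩
      α ℤ.* ℤ.0ℤ ℤ.+ (q ℤ.* β ℤ.* ℤ.0ℤ ℤ.+ (ε ℤ.* Q ℤ.* ℤ.0ℤ ℤ.+ (ε ℤ.* α ℤ.* (q ℤ.* χ r)
           ℤ.+ (ε ℤ.* q ℤ.* β ℤ.* (ω ℤ.* ψ r) ℤ.+ (ℤ.- κ ℤ.* profile Q α β r ℤ.+ q ℤ.* Q)))))
        ≡⟨ collect ε (χ r) κ Q α (ψ r) q β ω ⟩
      (q ℤ.- κ) ℤ.* Q ℤ.+ (ε ℤ.* (ω ℤ.* q) ℤ.* β ℤ.- κ ℤ.* α) ℤ.* ψ r ℤ.+ q ℤ.* ((ε ℤ.* α ℤ.- κ ℤ.* β) ℤ.* χ r) ∎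
      where
      open ≡-Reasoning
      expand : ∀ ε x κ i Q α p q β y → (ℤ.1ℤ ℤ.+ ε ℤ.* x ℤ.- κ ℤ.* i) ℤ.* (Q ℤ.+ α ℤ.* p ℤ.+ q ℤ.* (β ℤ.* y)) ≡
        α ℤ.* p ℤ.+ (q ℤ.* β ℤ.* y ℤ.+ (ε ℤ.* Q ℤ.* x ℤ.+ (ε ℤ.* α ℤ.* (x ℤ.* p)
          ℤ.+ (ε ℤ.* q ℤ.* β ℤ.* (x ℤ.* y) ℤ.+ (ℤ.- κ ℤ.* (i ℤ.* (Q ℤ.+ α ℤ.* p ℤ.+ q ℤ.* (β ℤ.* y))) ℤ.+ Q)))))
      expand = ℤSolver.solve-∀
      collect : ∀ ε x κ Q α p q β ω → α ℤ.* ℤ.0ℤ ℤ.+ (q ℤ.* β ℤ.* ℤ.0ℤ ℤ.+ (ε ℤ.* Q ℤ.* ℤ.0ℤ ℤ.+ (ε ℤ.* α ℤ.* (q ℤ.* x)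
           ℤ.+ (ε ℤ.* q ℤ.* β ℤ.* (ω ℤ.* p) ℤ.+ (ℤ.- κ ℤ.* (Q ℤ.+ α ℤ.* p ℤ.+ q ℤ.* (β ℤ.* x)) ℤ.+ q ℤ.* Q))))) ≡
        (q ℤ.- κ) ℤ.* Q ℤ.+ (ε ℤ.* (ω ℤ.* q) ℤ.* β ℤ.- κ ℤ.* α) ℤ.* p ℤ.+ q ℤ.* ((ε ℤ.* α ℤ.- κ ℤ.* β) ℤ.* x)
      collect = ℤSolver.solve-∀
      step : ∀ c (f : Carrier → ℤ) {g : Carrier → ℤ} {x y} → ∑F f ≡ x → ∑F g ≡ y →
             ∑F (λ s → c ℤ.* f s ℤ.+ g s) ≡ c ℤ.* x ℤ.+ y
      step c f {g} ∑f ∑g = trans (∑-linear elements c f g) (cong₂ (λ x y → c ℤ.* x ℤ.+ y) ∑f ∑g)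
      at0 : ∑F (λ s → 𝟙 (s ≟ 0#) ℤ.* profile Q α β (r + - s)) ≡ profile Q α β r
      at0 = trans (∑-𝟙 0# (λ s → profile Q α β (r + - s)))
        (cong (profile Q α β) (+-cancelʳ 0# _ _ (trans (+-assoc r (- 0#) 0#) (cong (λ z → r + z) (-‿inverseˡ 0#)))))

    valueCount : ∀ {n} → ℤ → (Fin n → Carrier) → (Fin n → ℕ) → Carrier → ℤ
    valueCount {n} κ a h r = ∑T n (λ x → weight κ x ℤ.* 𝟙 (diagonal a h x ≟ r))

    valueCount-suc : ∀ {n} κ (a : Fin (suc n) → Carrier) h r → valueCount κ a h r ≡
      ∑F (λ x → ρ κ x ℤ.* valueCount κ (a ∘ suc) (h ∘ suc) (r + - (a zero * x ^ h zero)))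
    valueCount-suc {n} κ a h r = begin
      valueCount κ a h r
        ≡⟨ ∑T-suc _ (λ x≗y → cong₂ (λ w s → w ℤ.* 𝟙 (s ≟ r)) (weight-ext κ x≗y) (diagonal-cong a h x≗y)) ⟩
      ∑F (λ x → ∑T n (λ v → ρ κ x ℤ.* weight κ v ℤ.* 𝟙 ((a zero * x ^ h zero + diagonal (a ∘ suc) (h ∘ suc) v) ≟ r)))
        ≡⟨ ∑-cong elements (λ x → trans (∑-cong (allTuples n) (λ v → trans (ℤₚ.*-assoc (ρ κ x) _ _)
             (cong (λ i → ρ κ x ℤ.* (weight κ v ℤ.* i)) (𝟙-cong (_ ≟ r) (_ ≟ _) (to _ _) (from _ _)))))
             (∑-*ˡ (allTuples n) (ρ κ x) _)) ⟩
      ∑F (λ x → ρ κ x ℤ.* valueCount κ (a ∘ suc) (h ∘ suc) (r + - (a zero * x ^ h zero))) ∎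
      where
      open ≡-Reasoning
      to : ∀ y d → y + d ≡ r → d ≡ r + - y
      to y d eq = +-cancelʳ y d _ (trans (+-comm d y) (trans eq (sym
        (trans (+-assoc r (- y) y) (trans (cong (λ z → r + z) (-‿inverseˡ y)) (+-identityʳ r))))))
      from : ∀ y d → d ≡ r + - y → y + d ≡ r
      from y d eq = trans (+-comm y d) (trans (cong (_+ y) eq)
        (trans (+-assoc r (- y) y) (trans (cong (λ z → r + z) (-‿inverseˡ y)) (+-identityʳ r))))

    -- Splitting off the first variable is a convolution with its fibre function. The empty form
    -- takes only the value 0, and q times the delta at 0 is 1 + `ψ`, which gives the start `A` = 1,
    -- `B` = 0.
    valueCount-formula : ∀ {n} κ (a : Fin n → Carrier) h (ε : Fin n → ℤ) → (∀ j → HasFibres κ (a j) (h j) (ε j)) →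
      ∀ r → q ℤ.* valueCount κ a h r ≡
            profile ((q ℤ.- κ) ℤ.^ n) (A (ω ℤ.* q) κ (List.tabulate ε)) (B (ω ℤ.* q) κ (List.tabulate ε)) r
    valueCount-formula {zero} κ a h ε fibres r = trans
      (cong (λ i → q ℤ.* (ℤ.1ℤ ℤ.* i ℤ.+ ℤ.0ℤ)) (𝟙-cong (0# ≟ r) (r ≟ 0#) sym sym)) (finish q (𝟙 (r ≟ 0#)) (χ r))
      where
      finish : ∀ q i x → q ℤ.* (ℤ.1ℤ ℤ.* i ℤ.+ ℤ.0ℤ) ≡ ℤ.1ℤ ℤ.+ ℤ.1ℤ ℤ.* (q ℤ.* i ℤ.- ℤ.1ℤ) ℤ.+ q ℤ.* (ℤ.0ℤ ℤ.* x)
      finish = ℤSolver.solve-∀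
    valueCount-formula {suc n} κ a h ε fibres r = begin
      q ℤ.* valueCount κ a h r
        ≡⟨ cong (λ z → q ℤ.* z) (trans (valueCount-suc κ a h r)
             (pushforward (ρ κ) (λ x → a zero * x ^ h zero) (λ s → rest (r + - s)))) ⟩
      q ℤ.* ∑F (λ s → ∑F (λ x → ρ κ x ℤ.* 𝟙 ((a zero * x ^ h zero) ≟ s)) ℤ.* rest (r + - s))
        ≡⟨ sym (∑-*ˡ elements q _) ⟩
      ∑F (λ s → q ℤ.* (∑F (λ x → ρ κ x ℤ.* 𝟙 ((a zero * x ^ h zero) ≟ s)) ℤ.* rest (r + - s)))
        ≡⟨ ∑-cong elements (λ s → trans (move q (∑F (λ x → ρ κ x ℤ.* 𝟙 ((a zero * x ^ h zero) ≟ s))) (rest (r + - s))) (cong₂ ℤ._*_ (fibres zero s)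
             (valueCount-formula κ (a ∘ suc) (h ∘ suc) (ε ∘ suc) (fibres ∘ suc) (r + - s)))) ⟩
      ∑F (λ s → (ℤ.1ℤ ℤ.+ ε zero ℤ.* χ s ℤ.- κ ℤ.* 𝟙 (s ≟ 0#)) ℤ.* profile Q α β (r + - s))
        ≡⟨ convolve-profile κ (ε zero) Q α β r ⟩
      profile ((q ℤ.- κ) ℤ.^ suc n) (A (ω ℤ.* q) κ (List.tabulate ε)) (B (ω ℤ.* q) κ (List.tabulate ε)) r ∎
      where
      open ≡-Reasoning
      rest : Carrier → ℤ
      rest = valueCount κ (a ∘ suc) (h ∘ suc)
      Q α β : ℤ
      Q = (q ℤ.- κ) ℤ.^ n
      α = A (ω ℤ.* q) κ (List.tabulate (ε ∘ suc))
      β = B (ω ℤ.* q) κ (List.tabulate (ε ∘ suc))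
      move : ∀ q x y → q ℤ.* (x ℤ.* y) ≡ x ℤ.* (q ℤ.* y)
      move = ℤSolver.solve-∀

    count-formula : ∀ {n} κ (a : Fin n → Carrier) h (ε : Fin n → ℤ) → χ 0# ≡ ℤ.0ℤ →
      (∀ j → HasFibres κ (a j) (h j) (ε j)) →
      q ℤ.* count a κ h ≡ (q ℤ.- κ) ℤ.^ n ℤ.+ A (ω ℤ.* q) κ (List.tabulate ε) ℤ.* (q ℤ.- ℤ.1ℤ)
    count-formula {n} κ a h ε χ0≡0 fibres = trans (valueCount-formula κ a h ε fibres 0#)
      (trans (cong₂ (λ i x → (q ℤ.- κ) ℤ.^ n ℤ.+ α ℤ.* (q ℤ.* i ℤ.- ℤ.1ℤ) ℤ.+ q ℤ.* (β ℤ.* x))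
               (𝟙-yes (0# ≟ 0#) refl) χ0≡0)
             (finish ((q ℤ.- κ) ℤ.^ n) α q β))
      where
      α β : ℤ
      α = A (ω ℤ.* q) κ (List.tabulate ε)
      β = B (ω ℤ.* q) κ (List.tabulate ε)
      finish : ∀ Q α q β → Q ℤ.+ α ℤ.* (q ℤ.* ℤ.1ℤ ℤ.- ℤ.1ℤ) ℤ.+ q ℤ.* (β ℤ.* ℤ.0ℤ) ≡ Q ℤ.+ α ℤ.* (q ℤ.- ℤ.1ℤ)
      finish = ℤSolver.solve-∀

-- Elementary symmetric polynomials

sumTo : ℕ → (ℕ → ℤ) → ℤ
sumTo J f = sumℤ (List.applyUpTo f J)

sumTo-cong : ∀ J {f g : ℕ → ℤ} → (∀ j → f j ≡ g j) → sumTo J f ≡ sumTo J g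
sumTo-cong zero    f≗g = refl
sumTo-cong (suc J) f≗g = cong₂ ℤ._+_ (f≗g 0) (sumTo-cong J (f≗g ∘ suc))

sumTo-0 : ∀ J {f : ℕ → ℤ} → (∀ j → f j ≡ ℤ.0ℤ) → sumTo J f ≡ ℤ.0ℤ
sumTo-0 zero    f≗0 = refl
sumTo-0 (suc J) f≗0 = cong₂ ℤ._+_ (f≗0 0) (sumTo-0 J (f≗0 ∘ suc))

sumTo-linear : ∀ J c (f g : ℕ → ℤ) →
               sumTo J (λ j → c ℤ.* f j ℤ.+ g j) ≡ c ℤ.* sumTo J f ℤ.+ sumTo J g
sumTo-linear zero    c f g = zero-case c
  where
  zero-case : ∀ c → ℤ.0ℤ ≡ c ℤ.* ℤ.0ℤ ℤ.+ ℤ.0ℤ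
  zero-case = ℤSolver.solve-∀
sumTo-linear (suc J) c f g =
  trans (cong (λ s → c ℤ.* f 0 ℤ.+ g 0 ℤ.+ s) (sumTo-linear J c (f ∘ suc) (g ∘ suc)))
        (regroup c (f 0) (g 0) (sumTo J (f ∘ suc)) (sumTo J (g ∘ suc)))
  where
  regroup : ∀ c x y s t → c ℤ.* x ℤ.+ y ℤ.+ (c ℤ.* s ℤ.+ t) ≡ c ℤ.* (x ℤ.+ s) ℤ.+ (y ℤ.+ t)
  regroup = ℤSolver.solve-∀

module _ (w : ℤ) where

  -- If y is a formal square root of `w`, the product of the factors 1 + z y over the list is
  -- `evenPart` + y `oddPart`.
  evenPart oddPart : List ℤ → ℤ
  evenPart []       = ℤ.1ℤ
  evenPart (z ∷ zs) = z ℤ.* w ℤ.* oddPart zs ℤ.+ evenPart zs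
  oddPart []        = ℤ.0ℤ
  oddPart (z ∷ zs)  = z ℤ.* evenPart zs ℤ.+ oddPart zs

  -- For `κ` = 1 the factors are z y - 1. Taking -1 out of each leaves 1 - z y, and changing y to -y
  -- negates exactly the odd part.
  A-1 : ∀ zs → A w ℤ.1ℤ zs ≡ ℤ.-1ℤ ℤ.^ List.length zs ℤ.* evenPart zs
  B-1 : ∀ zs → B w ℤ.1ℤ zs ≡ ℤ.- (ℤ.-1ℤ ℤ.^ List.length zs ℤ.* oddPart zs)
  A-1 []       = refl
  A-1 (z ∷ zs) rewrite A-1 zs | B-1 zs = regroup z w (ℤ.-1ℤ ℤ.^ List.length zs) (evenPart zs) (oddPart zs)
    where
    regroup : ∀ z w p e o → z ℤ.* w ℤ.* (ℤ.- (p ℤ.* o)) ℤ.- ℤ.1ℤ ℤ.* (p ℤ.* e) ≡ ℤ.-1ℤ ℤ.* p ℤ.* (z ℤ.* w ℤ.* o ℤ.+ e)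
    regroup = ℤSolver.solve-∀
  B-1 []       = refl
  B-1 (z ∷ zs) rewrite A-1 zs | B-1 zs = regroup z (ℤ.-1ℤ ℤ.^ List.length zs) (evenPart zs) (oddPart zs)
    where
    regroup : ∀ z p e o → z ℤ.* (p ℤ.* e) ℤ.- ℤ.1ℤ ℤ.* (ℤ.- (p ℤ.* o)) ≡ ℤ.- (ℤ.-1ℤ ℤ.* p ℤ.* (z ℤ.* e ℤ.+ o))
    regroup = ℤSolver.solve-∀

  evenTerm oddTerm : List ℤ → ℕ → ℤ
  evenTerm zs j = w ℤ.^ j ℤ.* σ (j ℕ.+ j) zs
  oddTerm  zs j = w ℤ.^ j ℤ.* σ (suc (j ℕ.+ j)) zs

  evenTerm-suc : ∀ z zs j → evenTerm (z ∷ zs) (suc j) ≡ z ℤ.* w ℤ.* oddTerm zs j ℤ.+ evenTerm zs (suc j)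
  evenTerm-suc z zs j rewrite ℕₚ.+-suc j j =
    regroup z w (w ℤ.^ j) (σ (suc (j ℕ.+ j)) zs) (σ (suc (suc (j ℕ.+ j))) zs)
    where
    regroup : ∀ z w p s t → w ℤ.* p ℤ.* (z ℤ.* s ℤ.+ t) ≡ z ℤ.* w ℤ.* (p ℤ.* s) ℤ.+ w ℤ.* p ℤ.* t
    regroup = ℤSolver.solve-∀

  oddTerm-∷ : ∀ z zs j → oddTerm (z ∷ zs) j ≡ z ℤ.* evenTerm zs j ℤ.+ oddTerm zs j
  oddTerm-∷ z zs j = regroup z (w ℤ.^ j) (σ (j ℕ.+ j) zs) (σ (suc (j ℕ.+ j)) zs)
    where
    regroup : ∀ z p s t → p ℤ.* (z ℤ.* s ℤ.+ t) ≡ z ℤ.* (p ℤ.* s) ℤ.+ p ℤ.* t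
    regroup = ℤSolver.solve-∀

  -- The length bounds ensure that no nonzero σ is cut off: the last even degree summed is 2J, the
  -- last odd one is 2J - 1. Each parity is reduced to both parities of the tail, so the two
  -- inductions run together.
  evenPart≡∑ : ∀ zs J → List.length zs ℕ.≤ suc (J ℕ.+ J) →
               evenPart zs ≡ ℤ.1ℤ ℤ.+ sumTo J (evenTerm zs ∘ suc)
  oddPart≡∑  : ∀ zs J → List.length zs ℕ.≤ J ℕ.+ J → oddPart zs ≡ sumTo J (oddTerm zs)
  evenPart≡∑ [] J _ = sym (trans (cong (λ s → ℤ.1ℤ ℤ.+ s) (sumTo-0 J (λ j → ℤₚ.*-zeroʳ (w ℤ.^ suc j)))) refl)
  evenPart≡∑ (z ∷ zs) J (s≤s l≤2J) = begin
    z ℤ.* w ℤ.* oddPart zs ℤ.+ evenPart zs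
      ≡⟨ cong₂ (λ o e → z ℤ.* w ℤ.* o ℤ.+ e) (oddPart≡∑ zs J l≤2J) (evenPart≡∑ zs J (ℕₚ.m≤n⇒m≤1+n l≤2J)) ⟩
    z ℤ.* w ℤ.* sumTo J (oddTerm zs) ℤ.+ (ℤ.1ℤ ℤ.+ sumTo J (evenTerm zs ∘ suc))
      ≡⟨ regroup (z ℤ.* w ℤ.* sumTo J (oddTerm zs)) (sumTo J (evenTerm zs ∘ suc)) ⟩
    ℤ.1ℤ ℤ.+ (z ℤ.* w ℤ.* sumTo J (oddTerm zs) ℤ.+ sumTo J (evenTerm zs ∘ suc))
      ≡⟨ cong (λ s → ℤ.1ℤ ℤ.+ s) (sym (sumTo-linear J (z ℤ.* w) (oddTerm zs) (evenTerm zs ∘ suc))) ⟩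
    ℤ.1ℤ ℤ.+ sumTo J (λ j → z ℤ.* w ℤ.* oddTerm zs j ℤ.+ evenTerm zs (suc j))
      ≡⟨ cong (λ s → ℤ.1ℤ ℤ.+ s) (sumTo-cong J (λ j → sym (evenTerm-suc z zs j))) ⟩
    ℤ.1ℤ ℤ.+ sumTo J (evenTerm (z ∷ zs) ∘ suc) ∎
    where
    open ≡-Reasoning
    regroup : ∀ x y → x ℤ.+ (ℤ.1ℤ ℤ.+ y) ≡ ℤ.1ℤ ℤ.+ (x ℤ.+ y)
    regroup = ℤSolver.solve-∀
  oddPart≡∑ [] J _ = sym (sumTo-0 J (λ j → ℤₚ.*-zeroʳ (w ℤ.^ j)))
  oddPart≡∑ (z ∷ zs) (suc J) (s≤s l≤) = begin
    z ℤ.* evenPart zs ℤ.+ oddPart zs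
      ≡⟨ cong₂ (λ e o → z ℤ.* e ℤ.+ o) (evenPart≡∑ zs J l≤′)
           (oddPart≡∑ zs (suc J) (ℕₚ.m≤n⇒m≤1+n l≤)) ⟩
    -- The leading `evenTerm zs 0` computes to 1 and absorbs the separate summand.
    z ℤ.* sumTo (suc J) (evenTerm zs) ℤ.+ sumTo (suc J) (oddTerm zs)
      ≡⟨ sym (sumTo-linear (suc J) z (evenTerm zs) (oddTerm zs)) ⟩
    sumTo (suc J) (λ j → z ℤ.* evenTerm zs j ℤ.+ oddTerm zs j)
      ≡⟨ sumTo-cong (suc J) (λ j → sym (oddTerm-∷ z zs j)) ⟩
    sumTo (suc J) (oddTerm (z ∷ zs)) ∎
    where
    open ≡-Reasoning
    l≤′ : List.length zs ℕ.≤ suc (J ℕ.+ J)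
    l≤′ = subst (List.length zs ℕ.≤_) (ℕₚ.+-suc J J) l≤

-- Arithmetic of the exponents

<ᵇ-cases : ∀ m n → (m < n × (m <ᵇ n) ≡ true) ⊎ (n ≤ m × (m <ᵇ n) ≡ false)
<ᵇ-cases m       zero    = inj₂ (z≤n , refl)
<ᵇ-cases zero    (suc n) = inj₁ (s≤s z≤n , refl)
<ᵇ-cases (suc m) (suc n) with <ᵇ-cases m n
... | inj₁ (m<n , eq) = inj₁ (s≤s m<n , eq)
... | inj₂ (n≤m , eq) = inj₂ (s≤s n≤m , eq)

coprime-* : ∀ {x m n} → Coprime x m → Coprime x n → Coprime x (m ℕ.* n)
coprime-* x⊥m x⊥n (d∣x , d∣mn) =
  x⊥n (d∣x , coprime-divisor (λ (e∣d , e∣m) → x⊥m (∣-trans e∣d d∣x , e∣m)) d∣mn)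

odd⇒coprime-2 : ∀ {x} → ¬ (2 ∣ x) → Coprime x 2
odd⇒coprime-2 odd {zero}              (_ , 0∣2)   with () ← 0∣⇒≡0 0∣2
odd⇒coprime-2 odd {suc zero}          _           = refl
odd⇒coprime-2 odd {suc (suc zero)}    (2∣x , _)   = ⊥-elim (odd 2∣x)
odd⇒coprime-2 odd {suc (suc (suc c))} (_ , c∣2)   with s≤s (s≤s ()) ← ∣⇒≤ c∣2

ΠN : ∀ {n} → (Fin n → ℕ) → ℕ
ΠN {zero}  f = 1
ΠN {suc n} f = f zero ℕ.* ΠN (f ∘ suc)

coprime-ΠN : ∀ {n x} {f : Fin n → ℕ} → (∀ j → Coprime x (f j)) → Coprime x (ΠN f)
coprime-ΠN {zero}  x⊥f (_ , d∣1) = ∣1⇒≡1 d∣1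
coprime-ΠN {suc n} x⊥f = coprime-* (x⊥f zero) (coprime-ΠN (x⊥f ∘ suc))

∣ΠN : ∀ {n} (f : Fin n → ℕ) j → f j ∣ ΠN f
∣ΠN f zero    = ∣m⇒∣m*n (ΠN (f ∘ suc)) ∣-refl
∣ΠN f (suc j) = ∣n⇒∣m*n (f zero) (∣ΠN (f ∘ suc) j)

∣lcmF : ∀ {n} (f : Fin n → ℕ) j → f j ∣ lcmF f
∣lcmF f zero    = m∣lcm[m,n] (f zero) _
∣lcmF f (suc j) = ∣-trans (∣lcmF (f ∘ suc) j) (n∣lcm[m,n] (f zero) _)

*-div : ∀ {m M} → 1 ≤ m → m ∣ M → m ℕ.* (M div m) ≡ M
*-div {suc m} _ m∣M = m*[n/m]≡n m∣M

module ExponentArithmetic {n : ℕ} (t : ℕ) (d : Fin n → ℕ)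
  (odd  : ∀ (j : Fin n) → toℕ j < t → ¬ (2 ∣ d j))
  (even : ∀ (j : Fin n) → t ≤ toℕ j → 2 ∣ d j) where

  h d′ : Fin n → ℕ
  h j  = if toℕ j <ᵇ t then 1 else 2
  d′ j = if toℕ j <ᵇ t then d j else d j ℕ./ 2

  1≤h : ∀ j → 1 ≤ h j
  1≤h j with toℕ j <ᵇ t
  ... | true  = s≤s z≤n
  ... | false = s≤s z≤n

  h∣2 : ∀ j → h j ∣ 2
  h∣2 j with toℕ j <ᵇ t
  ... | true  = 1∣ 2
  ... | false = ∣-refl

  d≡h*d′ : ∀ j → d j ≡ h j ℕ.* d′ j
  d≡h*d′ j with <ᵇ-cases (toℕ j) t
  ... | inj₁ (_ , eq) rewrite eq = sym (ℕₚ.+-identityʳ (d j))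
  ... | inj₂ (t≤j , eq) rewrite eq = sym (m*[n/m]≡n (even j t≤j))

  h∣d : ∀ j → h j ∣ d j
  h∣d j = subst (h j ∣_) (sym (d≡h*d′ j)) (∣m⇒∣m*n (d′ j) ∣-refl)

  module _ (coprime : ∀ (i j : Fin n) → i ≢ j → Coprime (d′ i) (d′ j)) where

    others : Fin n → Fin n → ℕ
    others i j with j Fin.≟ i
    ... | yes _ = 1
    ... | no _  = d′ j

    -- The factor 2 lets an even `d j`, which is twice `d′ j`, divide `L i`. It costs nothing more
    -- than `h i` in the gcd with `d i`.
    L : Fin n → ℕ
    L i = 2 ℕ.* ΠN (others i)

    coprime-others : ∀ i → Coprime (d′ i) (ΠN (others i))
    coprime-others i = coprime-ΠN each
      where
      each : ∀ j → Coprime (d′ i) (others i j)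
      each j with j Fin.≟ i
      ... | yes _  = λ (_ , e∣1) → ∣1⇒≡1 e∣1
      ... | no j≢i = coprime i j (j≢i ∘ sym)

    d∣L : ∀ i j → j ≢ i → d j ∣ L i
    d∣L i j j≢i = subst (_∣ L i) (sym (d≡h*d′ j)) (*-pres-∣ (h∣2 j) (∣-trans d′∣others (∣ΠN (others i) j)))
      where
      d′∣others : d′ j ∣ others i j
      d′∣others with j Fin.≟ i
      ... | yes j≡i = ⊥-elim (j≢i j≡i)
      ... | no _    = ∣-refl

    -- An odd `d i` is coprime to 2 and to the remaining product. From an even one the 2 is taken
    -- out of both arguments, and coprime numbers remain.
    gcd-dL : ∀ i → gcd (d i) (L i) ≡ h i
    gcd-dL i = trans (cong (λ x → gcd x (L i)) (d≡h*d′ i)) (go (<ᵇ-cases (toℕ i) t) (coprime-others i))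
      where
      go : (toℕ i < t × (toℕ i <ᵇ t) ≡ true) ⊎ (t ≤ toℕ i × (toℕ i <ᵇ t) ≡ false) →
           Coprime (d′ i) (ΠN (others i)) → gcd (h i ℕ.* d′ i) (L i) ≡ h i
      go (inj₁ (i<t , eq)) ⊥others rewrite eq | ℕₚ.+-identityʳ (d i) =
        coprime⇒gcd≡1 (coprime-* {d i} {2} (odd⇒coprime-2 (odd i i<t)) ⊥others)
      go (inj₂ (_ , eq)) ⊥others rewrite eq =
        trans (sym (c*gcd[m,n]≡gcd[cm,cn] 2 (d i ℕ./ 2) (ΠN (others i)))) (cong (2 ℕ.*_) (coprime⇒gcd≡1 ⊥others))

-- The number of solutions

^-cancelˡ : ∀ p .{{_ : ℤ.NonZero p}} n {x y} → p ℤ.^ n ℤ.* x ≡ p ℤ.^ n ℤ.* y → x ≡ y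
^-cancelˡ p zero    {x} {y} eq = trans (sym (ℤₚ.*-identityˡ x)) (trans eq (ℤₚ.*-identityˡ y))
^-cancelˡ p (suc n) {x} {y} eq = ^-cancelˡ p n (ℤₚ.*-cancelˡ-≡ p _ _
  (trans (sym (ℤₚ.*-assoc p (p ℤ.^ n) x)) (trans eq (ℤₚ.*-assoc p (p ℤ.^ n) y))))

pos-^ : ∀ m n → + (m ℕ.^ n) ≡ (+ m) ℤ.^ n
pos-^ m zero    = refl
pos-^ m (suc n) = trans (ℤₚ.pos-* m (m ℕ.^ n)) (cong (λ z → + m ℤ.* z) (pos-^ m n))

^-distribʳ-*ℤ : ∀ x y n → (x ℤ.* y) ℤ.^ n ≡ x ℤ.^ n ℤ.* y ℤ.^ n
^-distribʳ-*ℤ x y zero    = refl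
^-distribʳ-*ℤ x y (suc n) = trans (cong (λ z → x ℤ.* y ℤ.* z) (^-distribʳ-*ℤ x y n)) (regroup x y (x ℤ.^ n) (y ℤ.^ n))
  where
  regroup : ∀ x y u v → x ℤ.* y ℤ.* (u ℤ.* v) ≡ (x ℤ.* u) ℤ.* (y ℤ.* v)
  regroup = ℤSolver.solve-∀

parity : ∀ n → ∃ λ p → n ≡ p ℕ.* 2 ⊎ n ≡ suc (p ℕ.* 2)
parity zero    = 0 , inj₁ refl
parity (suc n) with parity n
... | p , inj₁ eq = p , inj₂ (cong suc eq)
... | p , inj₂ eq = suc p , inj₁ (cong suc eq)

n≤1+2[n/2] : ∀ n → n ≤ suc (n ℕ./ 2 ℕ.+ n ℕ./ 2)
n≤1+2[n/2] n = begin
  n                              ≡⟨ m≡m%n+[m/n]*n n 2 ⟩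
  n % 2 ℕ.+ n ℕ./ 2 ℕ.* 2        ≤⟨ ℕₚ.+-mono-≤ (ℕ.s≤s⁻¹ (m%n<n n 2)) (ℕₚ.≤-reflexive (trans (ℕₚ.*-comm (n ℕ./ 2) 2)
                                      (cong (n ℕ./ 2 ℕ.+_) (ℕₚ.+-identityʳ (n ℕ./ 2))))) ⟩
  suc (n ℕ./ 2 ℕ.+ n ℕ./ 2)      ∎
  where open ℕₚ.≤-Reasoning

-- A zero entry contributes the trivial factor 1 to the generating product, so the linear variables
-- disappear.
evenPart-drop : ∀ w {n} t (f : Fin n → ℤ) →
  evenPart w (List.tabulate (λ j → if toℕ j <ᵇ t then ℤ.0ℤ else f j)) ≡ evenPart w (List.drop t (List.tabulate f))
evenPart-drop w {zero}  zero    f = refl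
evenPart-drop w {zero}  (suc t) f = refl
evenPart-drop w {suc n} zero    f = refl
evenPart-drop w {suc n} (suc t) f = trans (ℤₚ.+-identityˡ _) (evenPart-drop w t (f ∘ suc))

drop-all-tabulate : ∀ {n} (f : Fin n → ℤ) → List.drop n (List.tabulate f) ≡ []
drop-all-tabulate {zero}  f = refl
drop-all-tabulate {suc n} f = drop-all-tabulate (f ∘ suc)

-- For `κ` = 0 every factor is a multiple of `χ`, and two of them convolve to a multiple of the
-- unit. So `A` consumes its list in pairs, and an odd length ends in 0.
A-0-∷∷ : ∀ w x y zs → A w ℤ.0ℤ (x ∷ y ∷ zs) ≡ x ℤ.* w ℤ.* y ℤ.* A w ℤ.0ℤ zs
A-0-∷∷ w x y zs = regroup w x y (A w ℤ.0ℤ zs) (B w ℤ.0ℤ zs) (A w ℤ.0ℤ (y ∷ zs))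
  where
  regroup : ∀ w x y α β γ → x ℤ.* w ℤ.* (y ℤ.* α ℤ.- ℤ.0ℤ ℤ.* β) ℤ.- ℤ.0ℤ ℤ.* γ ≡ x ℤ.* w ℤ.* y ℤ.* α
  regroup = ℤSolver.solve-∀

A-0-odd : ∀ w p (f : Fin (suc (p ℕ.* 2)) → ℤ) → A w ℤ.0ℤ (List.tabulate f) ≡ ℤ.0ℤ
A-0-odd w zero    f = regroup w (f zero)
  where
  regroup : ∀ w x → x ℤ.* w ℤ.* ℤ.0ℤ ℤ.- ℤ.0ℤ ℤ.* ℤ.1ℤ ≡ ℤ.0ℤ
  regroup = ℤSolver.solve-∀
A-0-odd w (suc p) f = trans (A-0-∷∷ w (f zero) (f (suc zero)) (List.tabulate (λ j → f (suc (suc j)))))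
  (trans (cong (λ z → f zero ℤ.* w ℤ.* f (suc zero) ℤ.* z) (A-0-odd w p (λ j → f (suc (suc j))))) (ℤₚ.*-zeroʳ (f zero ℤ.* w ℤ.* f (suc zero))))

-- The hypotheses give (q - 1)(N₁ - C₁) = X - q C₁ = -A₁ (q - 1), so the large term X cancels and
-- the total is C₀ - A₁. The factor q (q - 1) is carried along until everything can be divided by
-- it.
combine : ∀ q .{{_ : ℤ.NonZero q}} .{{_ : ℤ.NonZero (q ℤ.- ℤ.1ℤ)}} C₀ C₁ N₁ X A₀ A₁ q′ E s S →
  q ℤ.* C₀ ≡ q ℤ.* q′ ℤ.+ A₀ ℤ.* (q ℤ.- ℤ.1ℤ) →
  q ℤ.* C₁ ≡ X ℤ.+ A₁ ℤ.* (q ℤ.- ℤ.1ℤ) →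
  (q ℤ.- ℤ.1ℤ) ℤ.* N₁ ≡ X ℤ.- C₁ →
  A₀ ℤ.* (q ℤ.- ℤ.1ℤ) ≡ q ℤ.* E →
  A₁ ≡ ℤ.-1ℤ ℤ.* s ℤ.* (ℤ.1ℤ ℤ.+ S) →
  C₀ ℤ.- C₁ ℤ.+ N₁ ≡ q′ ℤ.+ s ℤ.+ s ℤ.* S ℤ.+ E
combine q C₀ C₁ N₁ X A₀ A₁ q′ E s S eq₀ eq₁ eqN eqE eqA =
  ℤₚ.*-cancelˡ-≡ q _ _ (ℤₚ.*-cancelˡ-≡ (q ℤ.- ℤ.1ℤ) _ _ (begin
    (q ℤ.- ℤ.1ℤ) ℤ.* (q ℤ.* (C₀ ℤ.- C₁ ℤ.+ N₁))
      ≡⟨ expand q C₀ C₁ N₁ ⟩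
    (q ℤ.- ℤ.1ℤ) ℤ.* (q ℤ.* C₀) ℤ.- q ℤ.* (q ℤ.* C₁) ℤ.+ q ℤ.* ((q ℤ.- ℤ.1ℤ) ℤ.* N₁ ℤ.+ C₁)
      ≡⟨ cong₂ (λ x y → (q ℤ.- ℤ.1ℤ) ℤ.* x ℤ.- q ℤ.* y ℤ.+ q ℤ.* ((q ℤ.- ℤ.1ℤ) ℤ.* N₁ ℤ.+ C₁))
           (trans eq₀ (cong (λ z → q ℤ.* q′ ℤ.+ z) eqE)) (trans eq₁ (cong (λ z → X ℤ.+ z ℤ.* (q ℤ.- ℤ.1ℤ)) eqA)) ⟩
    (q ℤ.- ℤ.1ℤ) ℤ.* (q ℤ.* q′ ℤ.+ q ℤ.* E) ℤ.- q ℤ.* (X ℤ.+ ℤ.-1ℤ ℤ.* s ℤ.* (ℤ.1ℤ ℤ.+ S) ℤ.* (q ℤ.- ℤ.1ℤ))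
      ℤ.+ q ℤ.* ((q ℤ.- ℤ.1ℤ) ℤ.* N₁ ℤ.+ C₁)
      ≡⟨ cong (λ z → (q ℤ.- ℤ.1ℤ) ℤ.* (q ℤ.* q′ ℤ.+ q ℤ.* E) ℤ.- q ℤ.* (X ℤ.+ ℤ.-1ℤ ℤ.* s ℤ.* (ℤ.1ℤ ℤ.+ S) ℤ.* (q ℤ.- ℤ.1ℤ))
           ℤ.+ q ℤ.* (z ℤ.+ C₁)) eqN ⟩
    (q ℤ.- ℤ.1ℤ) ℤ.* (q ℤ.* q′ ℤ.+ q ℤ.* E) ℤ.- q ℤ.* (X ℤ.+ ℤ.-1ℤ ℤ.* s ℤ.* (ℤ.1ℤ ℤ.+ S) ℤ.* (q ℤ.- ℤ.1ℤ))
      ℤ.+ q ℤ.* (X ℤ.- C₁ ℤ.+ C₁)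
      ≡⟨ collect q C₁ X q′ E s S ⟩
    (q ℤ.- ℤ.1ℤ) ℤ.* (q ℤ.* (q′ ℤ.+ s ℤ.+ s ℤ.* S ℤ.+ E)) ∎))
  where
  open ≡-Reasoning
  expand : ∀ q C₀ C₁ N₁ → (q ℤ.- ℤ.1ℤ) ℤ.* (q ℤ.* (C₀ ℤ.- C₁ ℤ.+ N₁)) ≡
    (q ℤ.- ℤ.1ℤ) ℤ.* (q ℤ.* C₀) ℤ.- q ℤ.* (q ℤ.* C₁) ℤ.+ q ℤ.* ((q ℤ.- ℤ.1ℤ) ℤ.* N₁ ℤ.+ C₁)
  expand = ℤSolver.solve-∀
  collect : ∀ q C₁ X q′ E s S →
    (q ℤ.- ℤ.1ℤ) ℤ.* (q ℤ.* q′ ℤ.+ q ℤ.* E) ℤ.- q ℤ.* (X ℤ.+ ℤ.-1ℤ ℤ.* s ℤ.* (ℤ.1ℤ ℤ.+ S) ℤ.* (q ℤ.- ℤ.1ℤ))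
      ℤ.+ q ℤ.* (X ℤ.- C₁ ℤ.+ C₁) ≡ (q ℤ.- ℤ.1ℤ) ℤ.* (q ℤ.* (q′ ℤ.+ s ℤ.+ s ℤ.* S ℤ.+ E))
  collect = ℤSolver.solve-∀

module Assembly (F : FiniteField) where
  open FiniteField F
  open FieldProperties F
  open Tuples F
  open Decomposition F
  open Powers F
  open FieldSize F

  -- The point x = 0 lies over 0, so excluding it affects only that fibre.
  fibre-ρ : ∀ κ (y : Carrier → Carrier) → y 0# ≡ 0# → ∀ s →
    ∑F (λ x → ρ κ x ℤ.* 𝟙 (y x ≟ s)) ≡ ∑F (λ x → 𝟙 (y x ≟ s)) ℤ.- κ ℤ.* 𝟙 (s ≟ 0#)
  fibre-ρ κ y y0≡0 s = begin
    ∑F (λ x → ρ κ x ℤ.* 𝟙 (y x ≟ s))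
      ≡⟨ ∑-cong elements (λ x → regroup κ (𝟙 (x ≟ 0#)) (𝟙 (y x ≟ s))) ⟩
    ∑F (λ x → ℤ.- κ ℤ.* (𝟙 (x ≟ 0#) ℤ.* 𝟙 (y x ≟ s)) ℤ.+ 𝟙 (y x ≟ s))
      ≡⟨ ∑-linear elements (ℤ.- κ) _ _ ⟩
    ℤ.- κ ℤ.* ∑F (λ x → 𝟙 (x ≟ 0#) ℤ.* 𝟙 (y x ≟ s)) ℤ.+ ∑F (λ x → 𝟙 (y x ≟ s))
      ≡⟨ cong (λ z → ℤ.- κ ℤ.* z ℤ.+ ∑F (λ x → 𝟙 (y x ≟ s))) (trans (∑-𝟙 0# (λ x → 𝟙 (y x ≟ s)))
           (𝟙-cong (y 0# ≟ s) (s ≟ 0#) (λ eq → trans (sym eq) y0≡0) (λ eq → trans y0≡0 (sym eq)))) ⟩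
    ℤ.- κ ℤ.* 𝟙 (s ≟ 0#) ℤ.+ ∑F (λ x → 𝟙 (y x ≟ s))
      ≡⟨ swap κ (𝟙 (s ≟ 0#)) (∑F (λ x → 𝟙 (y x ≟ s))) ⟩
    ∑F (λ x → 𝟙 (y x ≟ s)) ℤ.- κ ℤ.* 𝟙 (s ≟ 0#) ∎
    where
    open ≡-Reasoning
    regroup : ∀ κ i j → (ℤ.1ℤ ℤ.- κ ℤ.* i) ℤ.* j ≡ ℤ.- κ ℤ.* (i ℤ.* j) ℤ.+ j
    regroup = ℤSolver.solve-∀
    swap : ∀ κ i z → ℤ.- κ ℤ.* i ℤ.+ z ≡ z ℤ.- κ ℤ.* i
    swap = ℤSolver.solve-∀

  count-ax : ∀ {a} → a ≢ 0# → ∀ s → ∑F (λ x → 𝟙 ((a * x ^ 1) ≟ s)) ≡ ℤ.1ℤ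
  count-ax {a} a≢0 s = begin
    ∑F (λ x → 𝟙 ((a * x ^ 1) ≟ s))          ≡⟨ ∑-cong elements (λ x → trans (𝟙-cong (_ ≟ _) (x ≟ (a ⁻¹ * s))
      (λ eq → trans (sym (x⁻¹*[x*y]≡y x a≢0)) (cong (a ⁻¹ *_) (trans (cong (a *_) (sym (*-identityʳ x))) eq)))
      (λ eq → trans (cong (a *_) (trans (*-identityʳ x) eq)) (x*[x⁻¹*y]≡y s a≢0))) (sym (ℤₚ.*-identityʳ _))) ⟩
    ∑F (λ x → 𝟙 (x ≟ (a ⁻¹ * s)) ℤ.* ℤ.1ℤ)  ≡⟨ ∑-𝟙 (a ⁻¹ * s) (λ _ → ℤ.1ℤ) ⟩
    ℤ.1ℤ                                    ∎
    where open ≡-Reasoning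

  -- Both counts, multiplied by (q - 1)^n, equal `averaged κ h`, which does not mention `m`. For the
  -- exponents `h` themselves the twist is absorbed by z = 1 and y = v.
  count-reduce : ∀ {n} κ (a : Fin n → Carrier) {h m} (m′ : Fin n → ℕ) → (∀ j → m j ≡ m′ j ℕ.* h j) →
    (∀ j → 1 ≤ m′ j) → (∀ j → 1 ≤ h j) → PowersAbsorb a h m → count a κ m ≡ count a κ h
  count-reduce {n} κ a {h} {m} m′ m≡m′h 1≤m′ 1≤h absorb = ^-cancelˡ (q ℤ.- ℤ.1ℤ) n
    (trans (count-average a κ {h} {m} m′ m≡m′h 1≤m′ 1≤h absorb)
      (sym (count-average a κ {h} {h} (λ _ → 1) (λ j → sym (ℕₚ.*-identityˡ (h j))) (λ _ → s≤s z≤n) 1≤h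
        (λ v v≢0 → 1# , v , 1≢0 , v≢0 , λ i → sym (*-identityˡ _)))))

  -- The arguments `r`, `s`, `u` stand for n % 2, n / 2 and (n - 2) / 2; as parameters they can be
  -- replaced by their values without unfolding division.
  errorTerm : ∀ {n} → (Fin n → Carrier) → (r s u : ℕ) → ℤ
  errorTerm a r s u =
    if r ≡ᵇ 0 then η ((- 1#) ^ s * ΠF a) ℤ.* + (size ℕ.^ u) ℤ.* + (size ∸ 1) else ℤ.0ℤ

  module _ (n₁ : ℕ) (a : Fin (suc n₁) → Carrier) (a≢0 : ∀ j → a j ≢ 0#) (b : Carrier) (b≢0 : b ≢ 0#)
           (m : Fin (suc n₁) → ℕ) (1≤m : ∀ j → 1 ≤ m j) (k : ℕ) (1≤k : 1 ≤ k)
           (kk : Fin (suc n₁) → ℕ) (1≤kk : ∀ j → 1 ≤ kk j) (t : ℕ)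
           (gcd≡1 : gcd ℤ.∣ + ΣN (λ j → kk j ℕ.* (lcmF m div m j)) ℤ.- + (k ℕ.* lcmF m) ∣ (size ∸ 1) ≡ 1)
           (odd : ∀ (j : Fin (suc n₁)) → toℕ j < t → ¬ (2 ∣ gcd (m j) (size ∸ 1)))
           (even : ∀ (j : Fin (suc n₁)) → t ≤ toℕ j → 2 ∣ gcd (m j) (size ∸ 1)) where

    n : ℕ
    n = suc n₁

    d : Fin n → ℕ
    d j = gcd (m j) (size ∸ 1)

    open ExponentArithmetic {n} t d odd even

    module _ (coprime : ∀ (i j : Fin n) → i ≢ j → Coprime (d′ i) (d′ j)) where

      count-m≡count-h : ∀ κ → count a κ m ≡ count a κ h
      count-m≡count-h κ = count-reduce κ a (λ j → _∣_.quotient (h∣m j)) (λ j → _∣_.equality (h∣m j))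
        (λ j → 1≤quotient (1≤m j) (h∣m j)) 1≤h
        (powersAbsorb a h m d (L coprime) (λ _ → refl) (gcd-dL coprime) (d∣L coprime))
        where
        h∣m : ∀ j → h j ∣ m j
        h∣m j = ∣-trans (h∣d j) (gcd[m,n]∣m (m j) (size ∸ 1))
        1≤quotient : ∀ {x y} → 1 ≤ y → (x∣y : x ∣ y) → 1 ≤ _∣_.quotient x∣y
        1≤quotient () (divides zero refl)
        1≤quotient _  (divides (suc _) _) = s≤s z≤n

      module _ (χ : Carrier → ℤ) (ω : ℤ) (∑-χ : ∑F χ ≡ ℤ.0ℤ)
               (χ-convolution : ∀ r → ∑F (λ s → χ s ℤ.* χ (r + - s)) ≡ ω ℤ.* ψ r) (χ0≡0 : χ 0# ≡ ℤ.0ℤ)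
               (count-χ : ∀ j → t ≤ toℕ j → ∀ s → ∑F (λ x → 𝟙 ((a j * x ^ 2) ≟ s)) ≡ ℤ.1ℤ ℤ.+ χ (a j) ℤ.* χ s) where

        ε : Fin n → ℤ
        ε j = if toℕ j <ᵇ t then ℤ.0ℤ else χ (a j)

        fibres : ∀ κ j → DiagonalCount.HasFibres F χ ω ∑-χ χ-convolution κ (a j) (h j) (ε j)
        fibres κ j s = trans (fibre-ρ κ (λ x → a j * x ^ h j)
            (trans (cong (a j *_) (0^n≡0 (1≤h j))) (zeroʳ (a j))) s)
          (cong (λ z → z ℤ.- κ ℤ.* 𝟙 (s ≟ 0#)) (unweighted (<ᵇ-cases (toℕ j) t)))
          where
          unweighted : (toℕ j < t × (toℕ j <ᵇ t) ≡ true) ⊎ (t ≤ toℕ j × (toℕ j <ᵇ t) ≡ false) →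
                       ∑F (λ x → 𝟙 ((a j * x ^ h j) ≟ s)) ≡ ℤ.1ℤ ℤ.+ ε j ℤ.* χ s
          unweighted (inj₁ (_ , eq)) rewrite eq = count-ax (a≢0 j) s
          unweighted (inj₂ (t≤j , eq)) rewrite eq = count-χ j t≤j s

        -- `E` and `S` are specified by what they must contribute: `E` to the count with `κ` = 0,
        -- `S` to the one with `κ` = 1. This leaves the choice of `χ` open.
        N-formula : ∀ E S →
          A (ω ℤ.* q) ℤ.0ℤ (List.tabulate ε) ℤ.* (q ℤ.- ℤ.1ℤ) ≡ q ℤ.* E →
          evenPart (ω ℤ.* q) (List.drop t (List.tabulate (χ ∘ a))) ≡ ℤ.1ℤ ℤ.+ S →
          + N[ (λ x → ΣF (λ j → a j * x j ^ m j) ^ k) ≐ (λ x → b * ΠF (λ j → x j ^ kk j)) ] ≡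
          + (size ℕ.^ n₁) ℤ.+ ℤ.-1ℤ ℤ.^ n₁ ℤ.+ ℤ.-1ℤ ℤ.^ n₁ ℤ.* S ℤ.+ E
        N-formula E S eqE eqS = trans (N-split a b b≢0 m k 1≤k kk 1≤kk)
          (combine q C₀ C₁ N₁ ((q ℤ.- ℤ.1ℤ) ℤ.^ n) A₀ A₁ (+ (size ℕ.^ n₁)) E (ℤ.-1ℤ ℤ.^ n₁) S eq₀ eq₁ eqN eqE eqA)
          where
          C₀ C₁ N₁ A₀ A₁ : ℤ
          C₀ = count a ℤ.0ℤ m
          C₁ = count a ℤ.1ℤ m
          N₁ = nonzeroSolutions a b b≢0 m k 1≤k kk 1≤kk
          A₀ = A (ω ℤ.* q) ℤ.0ℤ (List.tabulate ε)
          A₁ = A (ω ℤ.* q) ℤ.1ℤ (List.tabulate ε)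
          formula : ∀ κ → q ℤ.* count a κ m ≡
                    (q ℤ.- κ) ℤ.^ n ℤ.+ A (ω ℤ.* q) κ (List.tabulate ε) ℤ.* (q ℤ.- ℤ.1ℤ)
          formula κ = trans (cong (λ z → q ℤ.* z) (count-m≡count-h κ))
            (DiagonalCount.count-formula F χ ω ∑-χ χ-convolution κ a h ε χ0≡0 (fibres κ))
          eq₀ : q ℤ.* C₀ ≡ q ℤ.* + (size ℕ.^ n₁) ℤ.+ A₀ ℤ.* (q ℤ.- ℤ.1ℤ)
          eq₀ = trans (formula ℤ.0ℤ) (cong (λ z → z ℤ.+ A₀ ℤ.* (q ℤ.- ℤ.1ℤ))
            (trans (cong (ℤ._^ n) (ℤₚ.+-identityʳ q)) (cong (λ z → q ℤ.* z) (sym (pos-^ size n₁)))))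
          eq₁ : q ℤ.* C₁ ≡ (q ℤ.- ℤ.1ℤ) ℤ.^ n ℤ.+ A₁ ℤ.* (q ℤ.- ℤ.1ℤ)
          eq₁ = formula ℤ.1ℤ
          eqN : (q ℤ.- ℤ.1ℤ) ℤ.* N₁ ≡ (q ℤ.- ℤ.1ℤ) ℤ.^ n ℤ.- C₁
          eqN = nonzeroSolutions-count a b b≢0 m k 1≤k kk 1≤kk (lcmF m) (λ j → lcmF m div m j)
            (λ j → *-div (1≤m j) (∣lcmF m j)) (uniqueScale (k ℕ.* lcmF m) _ gcd≡1)
          eqA : A₁ ≡ ℤ.-1ℤ ℤ.* ℤ.-1ℤ ℤ.^ n₁ ℤ.* (ℤ.1ℤ ℤ.+ S)
          eqA = trans (A-1 (ω ℤ.* q) (List.tabulate ε)) (cong₂ (λ l z → ℤ.-1ℤ ℤ.^ l ℤ.* z)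
            (length-tabulate ε) (trans (evenPart-drop (ω ℤ.* q) t (χ ∘ a)) eqS))

  module OddSize (1+1≢0 : 1# + 1# ≢ 0#) where
    open QuadraticCharacter F 1+1≢0

    w : ℤ
    w = η (- 1#) ℤ.* q

    -- Each pair of variables contributes q, one factor η(-1), and the characters of its two
    -- coefficients; multiplicativity collects them.
    A-0-even : ∀ p (a : Fin (p ℕ.* 2) → Carrier) →
               A w ℤ.0ℤ (List.tabulate (η ∘ a)) ≡ η ((- 1#) ^ p * ΠF a) ℤ.* q ℤ.^ p
    A-0-even zero    a = trans (sym η-1) (trans (cong η (sym (*-identityˡ 1#))) (sym (ℤₚ.*-identityʳ _)))
    A-0-even (suc p) a = begin
      A w ℤ.0ℤ (List.tabulate (η ∘ a))
        ≡⟨ A-0-∷∷ w (η a₀) (η a₁) (List.tabulate (η ∘ a₂)) ⟩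
      η a₀ ℤ.* w ℤ.* η a₁ ℤ.* A w ℤ.0ℤ (List.tabulate (η ∘ a₂))
        ≡⟨ cong (λ z → η a₀ ℤ.* w ℤ.* η a₁ ℤ.* z) (trans (A-0-even p a₂)
             (cong (λ z → z ℤ.* q ℤ.^ p) (η-* ((- 1#) ^ p) (ΠF a₂)))) ⟩
      η a₀ ℤ.* w ℤ.* η a₁ ℤ.* (η ((- 1#) ^ p) ℤ.* η (ΠF a₂) ℤ.* q ℤ.^ p)
        ≡⟨ regroup (η a₀) (η (- 1#)) q (η a₁) (η ((- 1#) ^ p)) (η (ΠF a₂)) (q ℤ.^ p) ⟩
      (η (- 1#) ℤ.* η ((- 1#) ^ p)) ℤ.* (η a₀ ℤ.* (η a₁ ℤ.* η (ΠF a₂))) ℤ.* (q ℤ.* q ℤ.^ p)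
        ≡⟨ cong (λ z → z ℤ.* (q ℤ.* q ℤ.^ p)) (sym (trans (η-* ((- 1#) ^ suc p) (ΠF a))
             (cong₂ ℤ._*_ (η-* (- 1#) ((- 1#) ^ p))
               (trans (η-* a₀ (a₁ * ΠF a₂)) (cong (λ z → η a₀ ℤ.* z) (η-* a₁ (ΠF a₂))))))) ⟩
      η ((- 1#) ^ suc p * ΠF a) ℤ.* q ℤ.^ suc p ∎
      where
      open ≡-Reasoning
      a₀ = a zero
      a₁ = a (suc zero)
      a₂ : Fin (p ℕ.* 2) → Carrier
      a₂ j = a (suc (suc j))
      regroup : ∀ x o q y s z r → x ℤ.* (o ℤ.* q) ℤ.* y ℤ.* (s ℤ.* z ℤ.* r) ≡ (o ℤ.* s) ℤ.* (x ℤ.* (y ℤ.* z)) ℤ.* (q ℤ.* r)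
      regroup = ℤSolver.solve-∀

    -- For even n the power q^(n/2) gives up one factor q, which leaves the exponent (n - 2) / 2.
    -- For odd n both sides are 0.
    A-0-errorTerm : ∀ {n} → 1 ≤ n → (a : Fin n → Carrier) →
      A w ℤ.0ℤ (List.tabulate (η ∘ a)) ℤ.* (q ℤ.- ℤ.1ℤ) ≡ q ℤ.* errorTerm a (n % 2) (n ℕ./ 2) ((n ∸ 2) ℕ./ 2)
    A-0-errorTerm {n} 1≤n a with parity n
    A-0-errorTerm () a | zero , inj₁ refl
    ... | suc p , inj₁ refl = begin
      A w ℤ.0ℤ (List.tabulate (η ∘ a)) ℤ.* (q ℤ.- ℤ.1ℤ)
        ≡⟨ cong (ℤ._* (q ℤ.- ℤ.1ℤ)) (A-0-even (suc p) a) ⟩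
      s ℤ.* (q ℤ.* q ℤ.^ p) ℤ.* (q ℤ.- ℤ.1ℤ)
        ≡⟨ regroup s q (q ℤ.^ p) (q ℤ.- ℤ.1ℤ) ⟩
      q ℤ.* (s ℤ.* q ℤ.^ p ℤ.* (q ℤ.- ℤ.1ℤ))
        ≡⟨ cong₂ (λ x y → q ℤ.* (s ℤ.* x ℤ.* y)) (sym (pos-^ size p)) (sym +[size∸1]≡q-1) ⟩
      q ℤ.* errorTerm a 0 (suc p) p
        ≡⟨ cong (λ z → q ℤ.* z) (trans (cong₂ (λ x y → errorTerm a x y p) (sym (m*n%n≡0 (suc p) 2)) (sym (m*n/n≡m (suc p) 2)))
             (cong (errorTerm a (suc p ℕ.* 2 % 2) (suc p ℕ.* 2 ℕ./ 2)) (sym (m*n/n≡m p 2)))) ⟩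
      q ℤ.* errorTerm a (suc p ℕ.* 2 % 2) (suc p ℕ.* 2 ℕ./ 2) (p ℕ.* 2 ℕ./ 2) ∎
      where
      open ≡-Reasoning
      s = η ((- 1#) ^ suc p * ΠF a)
      regroup : ∀ s q r p → s ℤ.* (q ℤ.* r) ℤ.* p ≡ q ℤ.* (s ℤ.* r ℤ.* p)
      regroup = ℤSolver.solve-∀
    ... | p , inj₂ refl = trans (cong (ℤ._* (q ℤ.- ℤ.1ℤ)) (A-0-odd w p (η ∘ a)))
      (trans (sym (ℤₚ.*-zeroʳ q)) (cong (λ r → q ℤ.* errorTerm a r (suc (p ℕ.* 2) ℕ./ 2) ((suc (p ℕ.* 2) ∸ 2) ℕ./ 2))
        (sym ([m+kn]%n≡m%n 1 p 2))))

    evenPart-sum : ∀ zs J → List.length zs ≤ suc (J ℕ.+ J) → evenPart w zs ≡ ℤ.1ℤ ℤ.+ sumℤ (List.map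
      (λ i → let j = suc i in η ((- 1#) ^ j) ℤ.* σ (2 ℕ.* j) zs ℤ.* + (size ℕ.^ j)) (List.upTo J))
    evenPart-sum zs J l≤ = trans (evenPart≡∑ w zs J l≤) (cong (λ z → ℤ.1ℤ ℤ.+ z)
      (trans (sumTo-cong J (λ i → term (suc i))) (cong sumℤ (sym (map-upTo _ J)))))
      where
      open ≡-Reasoning
      regroup : ∀ o r s → o ℤ.* r ℤ.* s ≡ o ℤ.* s ℤ.* r
      regroup = ℤSolver.solve-∀
      term : ∀ j → evenTerm w zs j ≡ η ((- 1#) ^ j) ℤ.* σ (2 ℕ.* j) zs ℤ.* + (size ℕ.^ j)
      term j = begin
        w ℤ.^ j ℤ.* σ (j ℕ.+ j) zs
          ≡⟨ cong₂ ℤ._*_ (^-distribʳ-*ℤ (η (- 1#)) q j) (cong (λ i → σ (j ℕ.+ i) zs) (sym (ℕₚ.+-identityʳ j))) ⟩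
        η (- 1#) ℤ.^ j ℤ.* q ℤ.^ j ℤ.* σ (2 ℕ.* j) zs
          ≡⟨ regroup (η (- 1#) ℤ.^ j) (q ℤ.^ j) (σ (2 ℕ.* j) zs) ⟩
        η (- 1#) ℤ.^ j ℤ.* σ (2 ℕ.* j) zs ℤ.* q ℤ.^ j
          ≡⟨ cong₂ (λ x y → x ℤ.* σ (2 ℕ.* j) zs ℤ.* y) (sym (η-^ (- 1#) j)) (sym (pos-^ size j)) ⟩
        η ((- 1#) ^ j) ℤ.* σ (2 ℕ.* j) zs ℤ.* + (size ℕ.^ j) ∎

  2∣size∸1⇒1+1≢0 : 2 ∣ size ∸ 1 → 1# + 1# ≢ 0#
  2∣size∸1⇒1+1≢0 (divides c eq) = odd-size⇒1+1≢0 c (trans size≡suc (cong suc eq))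

theorem4 :
  (F : FiniteField) → let open FiniteField F in
  (n : ℕ) → 2 ≤ n →
  (a : Fin n → Carrier) → (∀ j → a j ≢ 0#) →
  (b : Carrier) → b ≢ 0# →
  (m : Fin n → ℕ) → (∀ j → 1 ≤ m j) →
  (k : ℕ) → 1 ≤ k →
  (kk : Fin n → ℕ) → (∀ j → 1 ≤ kk j) →
  (t : ℕ) → t ≤ n →
  let q = size
      d = λ (j : Fin n) → gcd (m j) (q ∸ 1)
      M = lcmF m
      d′ = λ (j : Fin n) → if toℕ j <ᵇ t then d j else d j ℕ./ 2
      E = if (t ≡ᵇ 0) ∧ (n % 2 ≡ᵇ 0)
            then η ((- 1#) ^ (n ℕ./ 2) * ΠF a) ℤ.* + (q ℕ.^ ((n ∸ 2) ℕ./ 2)) ℤ.* + (q ∸ 1)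
            else ℤ.0ℤ
      sgn = ℤ.-1ℤ ℤ.^ (n ∸ 1)
  in
  gcd ℤ.∣ + ΣN (λ j → kk j ℕ.* (M div m j)) ℤ.- + (k ℕ.* M) ∣ (q ∸ 1) ≡ 1 →
  (∀ (j : Fin n) → toℕ j < t → ¬ (2 ∣ d j)) →
  (∀ (j : Fin n) → t ≤ toℕ j → 2 ∣ d j) →
  (∀ (i j : Fin n) → i ≢ j → Coprime (d′ i) (d′ j)) →
  + N[ (λ x → ΣF (λ j → a j * x j ^ m j) ^ k) ≐ (λ x → b * ΠF (λ j → x j ^ kk j)) ]
    ≡ + (q ℕ.^ (n ∸ 1)) ℤ.+ sgn
      ℤ.+ sgn ℤ.* sumℤ (List.map
            (λ i → let j = ℕ.suc i in
               η ((- 1#) ^ j)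
               ℤ.* σ (2 ℕ.* j) (List.drop t (List.tabulate (λ (l : Fin n) → η (a l))))
               ℤ.* + (q ℕ.^ j))
            (List.upTo ((n ∸ t) ℕ./ 2)))
      ℤ.+ E
theorem4 F (suc n₁) 2≤n a a≢0 b b≢0 m 1≤m k 1≤k kk 1≤kk t t≤n gcd≡1 odd even coprime
  with ℕₚ.m≤n⇒m<n∨m≡n t≤n
-- Here t = n: every exponent reduces to 1, so the zero function can serve as `χ`, and its condition
-- on quadratic terms is vacuous.
... | inj₂ refl = N-formula n₁ a a≢0 b b≢0 m 1≤m k 1≤k kk 1≤kk (suc n₁) gcd≡1 odd even coprime
    (λ _ → ℤ.0ℤ) ℤ.0ℤ (∑-0 elements) (λ _ → ∑-0 elements) refl
    (λ j n≤j → ⊥-elim (ℕₚ.<⇒≱ (toℕ<n j) n≤j))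
    ℤ.0ℤ _ (sym (ℤₚ.*-zeroʳ q))
    (trans (cong (evenPart (ℤ.0ℤ ℤ.* q)) (drop-all-tabulate {suc n₁} (λ _ → ℤ.0ℤ)))
      (cong (λ J → ℤ.1ℤ ℤ.+ sumℤ (List.map term (List.upTo (J ℕ./ 2)))) (sym (ℕₚ.n∸n≡0 n₁))))
  where
  open FiniteField F
  open Assembly F
  open FieldProperties F
  open Tuples F
  term : ℕ → ℤ
  term i = let j = ℕ.suc i in
    η ((- 1#) ^ j)
    ℤ.* σ (2 ℕ.* j) (List.drop (suc n₁) (List.tabulate (λ (l : Fin (suc n₁)) → η (a l))))
    ℤ.* + (size ℕ.^ j)
-- Here t < n: an even gcd exists, so q is odd and `η` can serve as `χ`.
... | inj₁ t<n = N-formula n₁ a a≢0 b b≢0 m 1≤m k 1≤k kk 1≤kk t gcd≡1 odd even coprime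
    η (η (- 1#)) ∑-η η-convolution (η-0 refl) (λ j _ → count-ax² (a≢0 j))
    _ _ (errorPart t) (evenPart-sum (List.drop t (List.tabulate (η ∘ a))) ((suc n₁ ∸ t) ℕ./ 2)
      (subst (_≤ suc (half ℕ.+ half)) (sym (trans (length-drop t (List.tabulate (η ∘ a)))
        (cong (_∸ t) (length-tabulate (η ∘ a))))) (n≤1+2[n/2] (suc n₁ ∸ t))))
  where
  open FiniteField F
  open Assembly F
  open FieldProperties F
  open Tuples F
  half : ℕ
  half = (suc n₁ ∸ t) ℕ./ 2
  1+1≢0 : 1# + 1# ≢ 0#
  -- Indices start at 0, so the index with value `t` is the first one whose gcd with q - 1 is even.
  1+1≢0 = 2∣size∸1⇒1+1≢0 (∣-trans (even (fromℕ< t<n) (ℕₚ.≤-reflexive (sym (toℕ-fromℕ< t<n))))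
    (gcd[m,n]∣n (m (fromℕ< t<n)) (size ∸ 1)))
  open OddSize 1+1≢0
  open QuadraticCharacter F 1+1≢0 using (∑-η; η-convolution; η-0; count-ax²)
  errorPart : ∀ t → A (η (- 1#) ℤ.* q) ℤ.0ℤ (List.tabulate (λ (j : Fin (suc n₁)) → if toℕ j <ᵇ t then ℤ.0ℤ else η (a j)))
      ℤ.* (q ℤ.- ℤ.1ℤ) ≡ q ℤ.* (if (t ≡ᵇ 0) ∧ (suc n₁ % 2 ≡ᵇ 0)
        then η ((- 1#) ^ (suc n₁ ℕ./ 2) * ΠF a) ℤ.* + (size ℕ.^ ((suc n₁ ∸ 2) ℕ./ 2)) ℤ.* + (size ∸ 1)
        else ℤ.0ℤ)
  errorPart zero    = A-0-errorTerm (s≤s z≤n) a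
  -- The first variable is linear, so its entry is 0; with `κ` = 0 this makes `A` compute to 0.
  errorPart (suc t) = sym (ℤₚ.*-zeroʳ q)
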